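{- For every integer $r\ge 3$ there exist propelinear perfect binary codes of length $2^{r+1}-1$ with kernel of dimension $2^{r+1}-2r-2$, and for every integer $r\ge 3$ there exist propelinear perfect binary codes of length $2^{r+1}-1$ that cannot be obtained by the Mollard construction, i.e. that are not equivalent to any perfect Mollard code.
   Context: $F=\mathrm{GF}(2)$; $F^n$ carries the Hamming metric; a code of length $n$ is a set of vectors of $F^n$, whose elements are called codewords. ${\bf 0}$ denotes the all-zero vector. A code $C\subseteq F^n$ is perfect if for every $x\in F^n$ there is exactly one $y\in C$ at Hamming distance at most $1$ from $x$. The kernel $\mathrm{Ker}(C)$ of a code $C$ of length $n$ is the set of all $x\in F^n$ with $x+C=C$ (a linear subspace). $\mathrm{Aut}(F^n)$ is the group of all transformations $(x,\pi)$, $x\in F^n$, $\pi$ a permutation of the coordinate positions, acting by $(x,\pi)(y)=x+\pi(y)$ where $\pi(y)=(y_{\pi^{ -1}(1)},\ldots,y_{\pi^{ -1}(n)})$. Two codes of length $n$ are equivalent if some element of $\mathrm{Aut}(F^n)$ maps one onto the other. $\mathrm{Aut}(C)$ is the setwise stabilizer of $C$ in $\mathrm{Aut}(F^n)$. A code $C$ is propelinear if $\mathrm{Aut}(C)$ has a subgroup of order $|C|$ acting transitively on the codewords of $C$. Mollard codes: let $C$ and $D$ be perfect codes of lengths $t$ and $m$ respectively, both containing the all-zero vector, and let $f:C\to F^m$ be any function. Index the coordinates of $F^{tm}$ by pairs $(i,j)$, $1\le i\le t$, $1\le j\le m$. Define $p_1:F^{tm}\to F^t$ and $p_2:F^{tm}\to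 F^m$ by $(p_1(x))_i=\sum_{j=1}^m x_{(i,j)}$, $(p_2(x))_j=\sum_{i=1}^t x_{(i,j)}$. Let $Z=\{(x|p_1(x)|p_2(x)):x\in F^{tm}\}$, where $|$ is concatenation. The (perfect) Mollard code of length $tm+t+m$ is $M(C,D)=\{({\bf 0}|y|z+f(y)): y\in C,\ z\in D\}+Z$. -}

module Defs where

open import Algebra.Bundles using (Group; CommutativeRing)
import Algebra.Properties.CommutativeMonoid.Sum as Sum
open import Data.Bool.Base using (Bool; true; false; _xor_; _∧_)
open import Data.Bool.Properties using
  (_≟_; xor-assoc; xor-identityʳ; xor-same; xor-∧-commutativeRing)
open import Data.Fin.Base using (Fin; combine)
open import Data.Fin.Permutation as Perm using
  (Permutation′; _⟨$⟩ʳ_; _⟨$⟩ˡ_; _∘ₚ_; inverseˡ; inverseʳ)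
open import Data.Nat.Base using (ℕ; _+_; _*_; _≤_; NonZero)
open import Data.Product using (Σ; ∃; ∃!; _×_; _,_; proj₁; proj₂)
open import Data.Vec.Base using (Vec; _++_; zip; zipWith; replicate; lookup; tabulate; count)
open import Data.Vec.Properties using
  (lookup-zipWith; lookup-replicate; lookup∘tabulate; tabulate∘lookup; tabulate-cong)
open import Function.Bundles using (Inverse)
open import Level using (0ℓ; _⊔_)
open import Relation.Binary.Bundles using (Setoid)
import Relation.Binary.Construct.On as On
open import Relation.Binary.PropositionalEquality using
  (_≡_; refl; sym; trans; cong; setoid; module ≡-Reasoning)
open import Relation.Nullary using (¬?)
open import Relation.Unary using (Pred; _∈_; _⊆_; _≐_)

private
  variable
    n : ℕ

-- GF(2) is the ring (Bool, xor, ∧).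
F : ℕ → Set
F = Vec Bool

infixl 6 _⊕_

_⊕_ : F n → F n → F n
_⊕_ = zipWith _xor_

𝟎 : F n
𝟎 = replicate _ false

open Sum (CommutativeRing.+-commutativeMonoid xor-∧-commutativeRing) public
  using (sum)

hammingDistance : F n → F n → ℕ
hammingDistance x y = count (λ p → ¬? (proj₁ p ≟ proj₂ p)) (zip x y)

linearCombination : ∀ {k} → F k → Vec (F n) k → F n
linearCombination a b = tabulate λ l → sum λ i → lookup a i ∧ lookup (lookup b i) l

record IsBasis {k} (V : Pred (F n) 0ℓ) (b : Vec (F n) k) : Set where
  field
    inside      : ∀ a → linearCombination a b ∈ V
    spanning    : ∀ {v} → v ∈ V → ∃ λ a → linearCombination a b ≡ v
    independent : ∀ a → linearCombination a b ≡ 𝟎 → a ≡ 𝟎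

HasDimension : Pred (F n) 0ℓ → ℕ → Set
HasDimension {n} V k = ∃ λ (b : Vec (F n) k) → IsBasis V b

Code : ℕ → Set₁
Code n = Pred (F n) 0ℓ

image : ∀ {m} → (F n → F m) → Code n → Code m
image f C y = ∃ λ x → x ∈ C × f x ≡ y

Perfect : Code n → Set
Perfect C = ∀ x → ∃! _≡_ λ y → y ∈ C × hammingDistance x y ≤ 1

Ker : Code n → Pred (F n) 0ℓ
Ker C x = image (x ⊕_) C ≐ C

permute : Permutation′ n → F n → F n
permute π y = tabulate λ i → lookup y (π ⟨$⟩ˡ i)

Transformation : ℕ → Set
Transformation n = F n × Permutation′ n

infixr 8 _•_

_•_ : Transformation n → F n → F n
(x , π) • y = x ⊕ permute π y

lookup-ext : {x y : F n} → (∀ i → lookup x i ≡ lookup y i) → x ≡ y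
lookup-ext {x = x} {y} eq =
  trans (sym (tabulate∘lookup x)) (trans (tabulate-cong eq) (tabulate∘lookup y))

lookup-• : ∀ (x : F n) π y i →
           lookup ((x , π) • y) i ≡ lookup x i xor lookup y (π ⟨$⟩ˡ i)
lookup-• x π y i = trans (lookup-zipWith _xor_ i x _)
  (cong (lookup x i xor_) (lookup∘tabulate _ i))

⟨$⟩ˡ-cong : {π ρ : Permutation′ n} → π Perm.≈ ρ → ∀ i → π ⟨$⟩ˡ i ≡ ρ ⟨$⟩ˡ i
⟨$⟩ˡ-cong {π = π} {ρ} π≈ρ i = begin
  π ⟨$⟩ˡ i                       ≡⟨ cong (π ⟨$⟩ˡ_) (inverseʳ ρ) ⟨
  π ⟨$⟩ˡ (ρ ⟨$⟩ʳ (ρ ⟨$⟩ˡ i))     ≡⟨ cong (π ⟨$⟩ˡ_) (π≈ρ _) ⟨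
  π ⟨$⟩ˡ (π ⟨$⟩ʳ (ρ ⟨$⟩ˡ i))     ≡⟨ inverseˡ π ⟩
  ρ ⟨$⟩ˡ i                       ∎
  where open ≡-Reasoning

permute-cong : {π ρ : Permutation′ n} → π Perm.≈ ρ → ∀ x → permute π x ≡ permute ρ x
permute-cong {π = π} {ρ} π≈ρ x =
  tabulate-cong λ i → cong (lookup x) (⟨$⟩ˡ-cong {π = π} {ρ} π≈ρ i)

⊕-same : (x : F n) → x ⊕ x ≡ 𝟎
⊕-same x = lookup-ext λ i → trans (lookup-zipWith _xor_ i x x)
  (trans (xor-same (lookup x i)) (sym (lookup-replicate i false)))

-- Composition in the order (g ∙ h) • y ≡ g • (h • y); `_∘ₚ_` composes
-- permutations from left to right, hence the swap.
infixl 7 _∙_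

_∙_ : Transformation n → Transformation n → Transformation n
(x , π) ∙ (y , ρ) = (x , π) • y , ρ ∘ₚ π

•-assoc : ∀ (g h : Transformation n) y → (g ∙ h) • y ≡ g • (h • y)
•-assoc (x , π) (y , ρ) z = lookup-ext λ i → begin
  lookup (((x , π) ∙ (y , ρ)) • z) i
    ≡⟨ lookup-• ((x , π) • y) (ρ ∘ₚ π) z i ⟩
  lookup ((x , π) • y) i xor lookup z (ρ ⟨$⟩ˡ (π ⟨$⟩ˡ i))
    ≡⟨ cong (_xor _) (lookup-• x π y i) ⟩
  (lookup x i xor lookup y (π ⟨$⟩ˡ i)) xor lookup z (ρ ⟨$⟩ˡ (π ⟨$⟩ˡ i))
    ≡⟨ xor-assoc (lookup x i) _ _ ⟩
  lookup x i xor (lookup y (π ⟨$⟩ˡ i) xor lookup z (ρ ⟨$⟩ˡ (π ⟨$⟩ˡ i)))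
    ≡⟨ cong (lookup x i xor_) (lookup-• y ρ z (π ⟨$⟩ˡ i)) ⟨
  lookup x i xor lookup ((y , ρ) • z) (π ⟨$⟩ˡ i)
    ≡⟨ lookup-• x π ((y , ρ) • z) i ⟨
  lookup ((x , π) • ((y , ρ) • z)) i ∎
  where open ≡-Reasoning

•-identity : (y : F n) → (𝟎 , Perm.id) • y ≡ y
•-identity y = lookup-ext λ i →
  trans (lookup-• 𝟎 Perm.id y i) (cong (_xor lookup y i) (lookup-replicate i false))

AutF : ℕ → Group 0ℓ 0ℓ
AutF n = record
  { Carrier = Transformation n
  ; _≈_     = λ (x , π) (y , ρ) → x ≡ y × π Perm.≈ ρ
  ; _∙_     = _∙_
  ; ε       = 𝟎 , Perm.id
  ; _⁻¹     = λ (x , π) → permute (Perm.flip π) x , Perm.flip π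
  ; isGroup = record
    { isMonoid = record
      { isSemigroup = record
        { isMagma = record
          { isEquivalence = record
            { refl  = refl , λ _ → refl
            ; sym   = λ (p , q) → sym p , λ i → sym (q i)
            ; trans = λ (p , q) (p′ , q′) → trans p p′ , λ i → trans (q i) (q′ i)
            }
          ; ∙-cong = λ { {_ , π} {_ , π′} {y , _} (refl , p) (refl , q) →
              cong (_ ⊕_) (permute-cong {π = π} {π′} p y) ,
              λ i → trans (cong (π ⟨$⟩ʳ_) (q i)) (p _) }
          }
        ; assoc = λ g h (z , _) → •-assoc g h z , λ _ → refl
        }
      ; identity = (λ (y , _) → •-identity y , λ _ → refl)
                 , (λ (x , π) → identityʳ x π , λ _ → refl)
      }
    ; inverse = (λ (x , π) → ⊕-same _ , λ _ → inverseˡ π)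
              , (λ (x , π) → inverse-right x π , λ _ → inverseʳ π)
    ; ⁻¹-cong = λ { {x , π} {_ , ρ} (refl , p) →
        tabulate-cong (λ i → cong (lookup x) (p i)) , ⟨$⟩ˡ-cong {π = π} {ρ} p }
    }
  }
  where
  identityʳ : ∀ (x : F n) π → (x , π) • 𝟎 ≡ x
  identityʳ x π = lookup-ext λ i → trans (lookup-• x π 𝟎 i)
    (trans (cong (lookup x i xor_) (lookup-replicate (π ⟨$⟩ˡ i) false))
           (xor-identityʳ (lookup x i)))

  inverse-right : ∀ (x : F n) π → (x , π) • permute (Perm.flip π) x ≡ 𝟎
  inverse-right x π = trans (cong (x ⊕_) (lookup-ext λ i →
    trans (lookup∘tabulate _ i) (trans (lookup∘tabulate _ (π ⟨$⟩ˡ i))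
      (cong (lookup x) (inverseʳ π))))) (⊕-same x)

MapsOnto : Transformation n → Code n → Code n → Set
MapsOnto g C D = image (g •_) C ≐ D

Equivalent : Code n → Code n → Set
Equivalent C D = ∃ λ g → MapsOnto g C D

Aut : Code n → Pred (Transformation n) 0ℓ
Aut C g = MapsOnto g C C

record IsSubgroup {c ℓ p} (G : Group c ℓ) (H : Pred (Group.Carrier G) p)
                  : Set (c ⊔ ℓ ⊔ p) where
  open Group G using (_≈_; ε; _⁻¹) renaming (_∙_ to _·_)
  field
    resp-≈    : ∀ {g h} → g ≈ h → g ∈ H → h ∈ H
    ε-closed  : ε ∈ H
    ∙-closed  : ∀ {g h} → g ∈ H → h ∈ H → g · h ∈ H
    ⁻¹-closed : ∀ {g} → g ∈ H → g ⁻¹ ∈ H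

-- A subset as a setoid: membership proofs are ignored by its equality.
subset : ∀ {a ℓ p} (S : Setoid a ℓ) → Pred (Setoid.Carrier S) p →
         Setoid (a ⊔ p) ℓ
subset S P = On.setoid {B = Σ (Setoid.Carrier S) P} S proj₁

TransitiveOn : Pred (Transformation n) 0ℓ → Code n → Set
TransitiveOn H C = ∀ {x y} → x ∈ C → y ∈ C → ∃ λ g → g ∈ H × g • x ≡ y

record Propelinear {n} (C : Code n) : Set₁ where
  field
    H          : Pred (Transformation n) 0ℓ
    isSubgroup : IsSubgroup (AutF n) H
    H⊆Aut      : H ⊆ Aut C
    -- |H| = |C|
    order      : Inverse (subset (Group.setoid (AutF n)) H)
                         (subset (setoid (F n)) C)
    transitive : TransitiveOn H C

module _ {t m : ℕ} where

  p₁ : F (t * m) → F t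
  p₁ x = tabulate λ i → sum λ (j : Fin m) → lookup x (combine i j)

  p₂ : F (t * m) → F m
  p₂ x = tabulate λ j → sum λ (i : Fin t) → lookup x (combine i j)

  Z : Code (t * m + t + m)
  Z w = ∃ λ x → w ≡ (x ++ p₁ x) ++ p₂ x

  -- The irrelevant argument of f makes it a function on the set C, with
  -- values that do not depend on membership proofs.
  Mollard : (C : Code t) (D : Code m) → (∀ y → .(y ∈ C) → F m) →
            Code (t * m + t + m)
  Mollard C D f w =
    Σ (F t) λ y → Σ (y ∈ C) λ y∈C → Σ (F m) λ z → z ∈ D ×
    ∃ λ u → u ∈ Z × w ≡ ((𝟎 {t * m} ++ y) ++ (z ⊕ f y y∈C)) ⊕ u

-- C and D have positive length: a component of length 0 would turn every
-- perfect code containing 𝟎 into a Mollard code.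
data IsMollard : ∀ {n} → Code n → Set₁ where
  mollard : ∀ {t m} .⦃ _ : NonZero t ⦄ .⦃ _ : NonZero m ⦄ {C : Code t} {D : Code m} →
            Perfect C → Perfect D → 𝟎 ∈ C → 𝟎 ∈ D →
            (f : ∀ y → .(y ∈ C) → F m) → IsMollard (Mollard C D f)

{-# OPTIONS --safe #-}

-- Let V = F^r, and let q be a quadratic form on V with polar form β and c a vector of its radical.
-- The involution ψ x = x + q(x) c satisfies ψ(u + v) = ψ u + T_u (ψ v) with the transvection
-- T_u x = x + β(u,x) c.  Take two such involutions ψ, ψ′ and, as in Solov'eva's concatenation, the
-- words (y | x), y of even weight indexed by V and x indexed by the nonzero vectors of V, such that
-- x and y have the Hamming syndromes ψ v and ψ′ v for some v ∈ V.  This code is perfect because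
-- ψ and ψ′ are bijections, and V acts on the coordinates of x and y by the linear maps T_v and
-- T′_v, which makes the code propelinear.  Computing ψ(ψ u + ψ v) = u + v + β(u,v) c shows that,
-- for independent c, c′ and polar forms without common radical, kernel words have zero
-- syndromes, so the kernel has codimension 2r + 1.  Then a kernel word of weight at most 3 has
-- y = 0, whereas in a Mollard code the kernel words (e_ij | e_i | e_j) cover all coordinates.
module Submission where

open import Defs
open import Data.Nat.Base using (ℕ; _+_; _*_; _∸_; _^_; _≤_)
open import Data.Product.Base using (∃; _×_)
open import Relation.Nullary using (¬_)
open import Algebra.Bundles using (CommutativeRing; CommutativeSemigroup; Group)
import Algebra.Properties.CommutativeMonoid.Sum as Sum
import Algebra.Properties.CommutativeSemigroup as CommutativeSemigroupProperties
open import Data.Bool.Base using (Bool; true; false; _xor_; _∧_; if_then_else_)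
open import Data.Bool.Properties using
  (_≟_; xor-assoc; xor-comm; xor-identityʳ; xor-same; xor-∧-commutativeRing;
   ∧-comm; ∧-distribʳ-xor; ∧-zeroʳ; ¬-not)
open import Data.Bool.Solver using (module xor-∧-Solver)
open import Data.Fin.Base as Fin using
  (Fin; zero; suc; _↑ˡ_; _↑ʳ_; punchIn; punchOut; combine; remQuot)
open import Data.Fin.Permutation as Perm using
  (Permutation′; permutation; _⟨$⟩ʳ_; _⟨$⟩ˡ_)
open import Data.Fin.Properties as Fin using
  (splitAt-↑ˡ; splitAt-↑ʳ; join-splitAt; punchInᵢ≢i; punchIn-punchOut; punchIn-injective;
   combine-remQuot; combine-injectiveˡ; combine-injectiveʳ; *↔×; 2↔Bool)
open import Data.Maybe.Base using (Maybe; just; nothing; maybe′)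
open import Data.Maybe.Properties using (just-injective)
open import Data.Nat.Base using (zero; suc; pred; z≤n; s≤s)
open import Data.Nat.Properties using
  (+-suc; +-comm; +-identityʳ; m+n∸n≡m; ∸-+-assoc; suc-pred; m^n≢0)
open import Data.Product using (∃₂; _,_; proj₁; proj₂; uncurry)
open import Data.Product.Function.NonDependent.Propositional using (_×-↔_)
open import Data.Sum.Base using ([_,_]′; inj₁; inj₂)
open import Data.Vec.Base using
  (Vec; []; _∷_; _++_; head; tail; lookup; tabulate; insertAt; removeAt; splitAt; _[_]≔_)
open import Data.Vec.Properties using
  (lookup-zipWith; lookup-replicate; lookup∘tabulate; lookup∘update; lookup∘update′;
   zipWith-assoc; zipWith-comm; zipWith-identityˡ; zipWith-identityʳ;
   ∷-injective; ∷-injectiveˡ; ++-injective; insertAt-removeAt; removeAt-insertAt; ≡-dec)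
open import Function.Bundles using (_↔_; mk↔ₛ′; module Inverse)
open import Function.Construct.Composition using (_↔-∘_)
open import Level using (0ℓ)
open import Relation.Binary.Definitions using (DecidableEquality)
open import Relation.Binary.PropositionalEquality
open import Relation.Nullary using (yes; no)
open import Relation.Nullary.Negation using (contradiction)
open import Relation.Unary using (Pred; _∈_; _⊆_; _≐_)

open ≡-Reasoning

open Sum (CommutativeRing.+-commutativeMonoid xor-∧-commutativeRing)
  using (sum-cong-≗; ∑-distrib-+; sum-replicate-zero)

private
  variable
    k l m n r t : ℕ

-- Vector arithmetic over GF(2).

⊕-assoc : (x y z : F n) → (x ⊕ y) ⊕ z ≡ x ⊕ (y ⊕ z)
⊕-assoc = zipWith-assoc xor-assoc

⊕-comm : (x y : F n) → x ⊕ y ≡ y ⊕ x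
⊕-comm = zipWith-comm xor-comm

⊕-identityˡ : (x : F n) → 𝟎 ⊕ x ≡ x
⊕-identityˡ = zipWith-identityˡ λ _ → refl

⊕-identityʳ : (x : F n) → x ⊕ 𝟎 ≡ x
⊕-identityʳ = zipWith-identityʳ xor-identityʳ

⊕-cancelˡ : (x y : F n) → x ⊕ (x ⊕ y) ≡ y
⊕-cancelˡ x y = begin
  x ⊕ (x ⊕ y)  ≡⟨ ⊕-assoc x x y ⟨
  (x ⊕ x) ⊕ y  ≡⟨ cong (_⊕ y) (⊕-same x) ⟩
  𝟎 ⊕ y        ≡⟨ ⊕-identityˡ y ⟩
  y            ∎

⊕-swap : {x y z : F n} → x ⊕ y ≡ z → y ≡ x ⊕ z
⊕-swap {x = x} {y} refl = sym (⊕-cancelˡ x y)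

⊕-zero : {x y : F n} → x ⊕ y ≡ 𝟎 → x ≡ y
⊕-zero {x = x} eq = sym (trans (⊕-swap eq) (⊕-identityʳ x))

⊕-commutativeSemigroup : ℕ → CommutativeSemigroup 0ℓ 0ℓ
⊕-commutativeSemigroup n = record
  { Carrier = F n
  ; _≈_ = _≡_
  ; _∙_ = _⊕_
  ; isCommutativeSemigroup = record
    { isSemigroup = record
      { isMagma = record { isEquivalence = isEquivalence ; ∙-cong = cong₂ _⊕_ }
      ; assoc = ⊕-assoc
      }
    ; comm = ⊕-comm
    }
  }

module _ {n : ℕ} where
  open CommutativeSemigroupProperties (⊕-commutativeSemigroup n) public
    using () renaming (interchange to ⊕-interchange; x∙yz≈y∙xz to ⊕-leftComm)

++-⊕ : (x x′ : F m) (y y′ : F n) → (x ++ y) ⊕ (x′ ++ y′) ≡ (x ⊕ x′) ++ (y ⊕ y′)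
++-⊕ []      []        y y′ = refl
++-⊕ (_ ∷ x) (_ ∷ x′) y y′ = cong (_ ∷_) (++-⊕ x x′ y y′)

𝟎++𝟎 : ∀ m → 𝟎 {m} ++ 𝟎 {n} ≡ 𝟎
𝟎++𝟎 zero    = refl
𝟎++𝟎 (suc m) = cong (false ∷_) (𝟎++𝟎 m)

-- Additive maps, unit vectors and linear combinations.

Additive : (F m → F n) → Set
Additive f = ∀ x y → f (x ⊕ y) ≡ f x ⊕ f y

additive-𝟎 : {f : F m → F n} → Additive f → f 𝟎 ≡ 𝟎
additive-𝟎 {f = f} add = begin
  f 𝟎                ≡⟨ ⊕-cancelˡ (f 𝟎) (f 𝟎) ⟨
  f 𝟎 ⊕ (f 𝟎 ⊕ f 𝟎)  ≡⟨ cong (f 𝟎 ⊕_) (add 𝟎 𝟎) ⟨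
  f 𝟎 ⊕ f (𝟎 ⊕ 𝟎)    ≡⟨ cong (λ z → f 𝟎 ⊕ f z) (⊕-identityˡ 𝟎) ⟩
  f 𝟎 ⊕ f 𝟎          ≡⟨ ⊕-same (f 𝟎) ⟩
  𝟎                  ∎

∘-additive : {f : F m → F n} {g : F l → F m} → Additive f → Additive g → Additive (λ x → f (g x))
∘-additive {f = f} f-add g-add x y = trans (cong f (g-add x y)) (f-add _ _)

unit : Fin n → F n
unit i = 𝟎 [ i ]≔ true

lookup-unit : (i : Fin n) → lookup (unit i) i ≡ true
lookup-unit i = lookup∘update i 𝟎 true

lookup-unit-≢ : {i j : Fin n} → i ≢ j → lookup (unit i) j ≡ false
lookup-unit-≢ {j = j} i≢j =
  trans (lookup∘update′ (λ j≡i → i≢j (sym j≡i)) 𝟎 true) (lookup-replicate j false)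

sum-unit : (i : Fin n) (f : Fin n → Bool) → sum (λ j → lookup (unit i) j ∧ f j) ≡ f i
sum-unit {suc n} zero f = begin
  f zero xor sum (λ j → lookup {n = n} 𝟎 j ∧ f (suc j))
    ≡⟨ cong (f zero xor_) (sum-cong-≗ λ j → cong (_∧ f (suc j)) (lookup-replicate j false)) ⟩
  f zero xor sum {n} (λ _ → false)
    ≡⟨ cong (f zero xor_) (sum-replicate-zero n) ⟩
  f zero xor false
    ≡⟨ xor-identityʳ (f zero) ⟩
  f zero ∎
sum-unit (suc i) f = sum-unit i λ j → f (suc j)

unit-combination : (b : Vec (F n) k) (i : Fin k) → linearCombination (unit i) b ≡ lookup b i
unit-combination b i = lookup-ext λ j →
  trans (lookup∘tabulate _ j) (sum-unit i λ i → lookup (lookup b i) j)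

linearCombination-additive : (b : Vec (F n) k) → Additive λ a → linearCombination a b
linearCombination-additive b x y = lookup-ext λ j → let f = λ i → lookup (lookup b i) j in begin
  lookup (linearCombination (x ⊕ y) b) j
    ≡⟨ lookup∘tabulate _ j ⟩
  sum (λ i → lookup (x ⊕ y) i ∧ f i)
    ≡⟨ sum-cong-≗ (λ i → trans (cong (_∧ f i) (lookup-zipWith _xor_ i x y))
                               (∧-distribʳ-xor (f i) (lookup x i) (lookup y i))) ⟩
  sum (λ i → (lookup x i ∧ f i) xor (lookup y i ∧ f i))
    ≡⟨ ∑-distrib-+ (λ i → lookup x i ∧ f i) (λ i → lookup y i ∧ f i) ⟩
  sum (λ i → lookup x i ∧ f i) xor sum (λ i → lookup y i ∧ f i)
    ≡⟨ cong₂ _xor_ (lookup∘tabulate _ j) (lookup∘tabulate _ j) ⟨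
  lookup (linearCombination x b) j xor lookup (linearCombination y b) j
    ≡⟨ lookup-zipWith _xor_ j (linearCombination x b) (linearCombination y b) ⟨
  lookup (linearCombination x b ⊕ linearCombination y b) j ∎

-- The only scalars are 0 and 1, so additive maps are linear and determined by their values on unit
-- vectors; the induction splits off the first coordinate.
additive-ext : {f g : F m → F n} → Additive f → Additive g →
               (∀ i → f (unit i) ≡ g (unit i)) → ∀ x → f x ≡ g x
additive-ext f-add g-add eq [] = trans (additive-𝟎 f-add) (sym (additive-𝟎 g-add))
additive-ext {f = f} {g} f-add g-add eq (b ∷ x) = begin
  f (b ∷ x)                    ≡⟨ cong f split ⟨
  f ((b ∷ 𝟎) ⊕ (false ∷ x))    ≡⟨ f-add _ _ ⟩
  f (b ∷ 𝟎) ⊕ f (false ∷ x)    ≡⟨ cong₂ _⊕_ (first b) rest ⟩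
  g (b ∷ 𝟎) ⊕ g (false ∷ x)    ≡⟨ g-add _ _ ⟨
  g ((b ∷ 𝟎) ⊕ (false ∷ x))    ≡⟨ cong g split ⟩
  g (b ∷ x)                    ∎
  where
  split = cong₂ _∷_ (xor-identityʳ b) (⊕-identityˡ x)

  first : ∀ b → f (b ∷ 𝟎) ≡ g (b ∷ 𝟎)
  first true  = eq zero
  first false = trans (additive-𝟎 f-add) (sym (additive-𝟎 g-add))

  rest = additive-ext (λ x y → f-add (false ∷ x) (false ∷ y))
                      (λ x y → g-add (false ∷ x) (false ∷ y)) (λ i → eq (suc i)) x

-- Syndromes and their behaviour under coordinate permutations.

opaque
  -- The linear map of the parity-check matrix with columns `col`. Being opaque, it enters later
  -- arguments only through additivity and its values on unit vectors.
  syndrome : (Fin n → F m) → F n → F m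
  syndrome col x = linearCombination x (tabulate col)

  syndrome-additive : (col : Fin n → F m) → Additive (syndrome col)
  syndrome-additive col = linearCombination-additive (tabulate col)

  syndrome-unit : (col : Fin n → F m) (i : Fin n) → syndrome col (unit i) ≡ col i
  syndrome-unit col i = trans (unit-combination (tabulate col) i) (lookup∘tabulate col i)

permute-additive : (π : Permutation′ n) → Additive (permute π)
permute-additive π x y = lookup-ext λ i → begin
  lookup (permute π (x ⊕ y)) i
    ≡⟨ lookup∘tabulate _ i ⟩
  lookup (x ⊕ y) (π ⟨$⟩ˡ i)
    ≡⟨ lookup-zipWith _xor_ (π ⟨$⟩ˡ i) x y ⟩
  lookup x (π ⟨$⟩ˡ i) xor lookup y (π ⟨$⟩ˡ i)
    ≡⟨ cong₂ _xor_ (lookup∘tabulate _ i) (lookup∘tabulate _ i) ⟨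
  lookup (permute π x) i xor lookup (permute π y) i
    ≡⟨ lookup-zipWith _xor_ i (permute π x) (permute π y) ⟨
  lookup (permute π x ⊕ permute π y) i ∎

permute-unit : (π : Permutation′ n) (i : Fin n) → permute π (unit i) ≡ unit (π ⟨$⟩ʳ i)
permute-unit π i = lookup-ext λ j → trans (lookup∘tabulate _ j) (entry j)
  where
  entry : ∀ j → lookup (unit i) (π ⟨$⟩ˡ j) ≡ lookup (unit (π ⟨$⟩ʳ i)) j
  entry j with π ⟨$⟩ʳ i Fin.≟ j
  ... | yes refl = begin
    lookup (unit i) (π ⟨$⟩ˡ j)  ≡⟨ cong (lookup (unit i)) (Perm.inverseˡ π) ⟩
    lookup (unit i) i           ≡⟨ lookup-unit i ⟩
    true                        ≡⟨ lookup-unit j ⟨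
    lookup (unit j) j           ∎
  ... | no πi≢j = begin
    lookup (unit i) (π ⟨$⟩ˡ j)  ≡⟨ lookup-unit-≢ {i = i} (λ { refl → πi≢j (Perm.inverseʳ π) }) ⟩
    false                       ≡⟨ lookup-unit-≢ πi≢j ⟨
    lookup (unit (π ⟨$⟩ʳ i)) j  ∎

-- Both sides are additive in `x`, so it is enough to compare unit vectors, where the hypothesis on
-- the columns applies directly.
syndrome-permute : (col : Fin n → F m) (π : Permutation′ n) {f : F m → F m} → Additive f →
                   (∀ i → col (π ⟨$⟩ʳ i) ≡ f (col i)) →
                   ∀ x → syndrome col (permute π x) ≡ f (syndrome col x)
syndrome-permute col π {f} f-add eq = additive-ext
  (∘-additive {f = syndrome col} {permute π} (syndrome-additive col) (permute-additive π))
  (∘-additive {f = f} {syndrome col} f-add (syndrome-additive col)) λ i → begin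
    syndrome col (permute π (unit i))  ≡⟨ cong (syndrome col) (permute-unit π i) ⟩
    syndrome col (unit (π ⟨$⟩ʳ i))     ≡⟨ syndrome-unit col (π ⟨$⟩ʳ i) ⟩
    col (π ⟨$⟩ʳ i)                     ≡⟨ eq i ⟩
    f (col i)                          ≡⟨ cong f (syndrome-unit col i) ⟨
    f (syndrome col (unit i))          ∎

-- Dimension, hyperplane sections and the nullity of a surjective linear map.

-- A basis packaged as an injective additive map: passing to a subspace is then composition with a
-- map of coefficient spaces, and no list of basis vectors has to be edited.
record Parametrisation (V : Pred (F n) 0ℓ) (k : ℕ) : Set where
  field
    to        : F k → F n
    additive  : Additive to
    inside    : ∀ a → to a ∈ V
    onto      : ∀ {v} → v ∈ V → ∃ λ a → to a ≡ v
    injective : ∀ a → to a ≡ 𝟎 → a ≡ 𝟎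

parametrisation⇒dimension : {V : Pred (F n) 0ℓ} → Parametrisation V k → HasDimension V k
parametrisation⇒dimension {V = V} p = b , record
  { inside      = λ a → subst V (sym (combination a)) (inside a)
  ; spanning    = λ v∈V → let a , eq = onto v∈V in a , trans (combination a) eq
  ; independent = λ a eq → injective a (trans (sym (combination a)) eq)
  }
  where
  open Parametrisation p

  b = tabulate λ i → to (unit i)

  combination : ∀ a → linearCombination a b ≡ to a
  combination = additive-ext (linearCombination-additive b) additive
    λ i → trans (unit-combination b i) (lookup∘tabulate (λ i → to (unit i)) i)

dimension-cong : {V W : Pred (F n) 0ℓ} → V ≐ W → HasDimension V k → HasDimension W k
dimension-cong (V⊆W , W⊆V) (b , basis) = b , record
  { inside      = λ a → V⊆W (inside a)
  ; spanning    = λ v∈W → spanning (W⊆V v∈W)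
  ; independent = independent
  }
  where open IsBasis basis

insertAt-⊕ : (x y : F n) (i : Fin (suc n)) (b c : Bool) →
             insertAt (x ⊕ y) i (b xor c) ≡ insertAt x i b ⊕ insertAt y i c
insertAt-⊕ x       y       zero    b c = refl
insertAt-⊕ (_ ∷ x) (_ ∷ y) (suc i) b c = cong (_ ∷_) (insertAt-⊕ x y i b c)

insertAt-𝟎 : (i : Fin (suc n)) → insertAt 𝟎 i false ≡ 𝟎
insertAt-𝟎         zero    = refl
insertAt-𝟎 {suc n} (suc i) = cong (false ∷_) (insertAt-𝟎 i)

insertAt-unit : (i : Fin (suc n)) → insertAt 𝟎 i true ≡ unit i
insertAt-unit         zero    = refl
insertAt-unit {suc n} (suc i) = cong (false ∷_) (insertAt-unit i)

xor-false : {x y : Bool} → x xor y ≡ false → x ≡ y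
xor-false {false} {false} _ = refl
xor-false {true}  {true}  _ = refl

-- On the hyperplane g = 0 the i-th coordinate is a function of the others as soon as g (unit i) = 1.
module _ {k} (g : F (suc k) → Bool) (g-add : ∀ x y → g (x ⊕ y) ≡ g x xor g y)
         (i : Fin (suc k)) (gi : g (unit i) ≡ true) where

  complete : F k → F (suc k)
  complete a = insertAt a i (g (insertAt a i false))

  g-insertAt : ∀ a b → g (insertAt a i b) ≡ g (insertAt a i false) xor b
  g-insertAt a false = sym (xor-identityʳ _)
  g-insertAt a true = begin
    g (insertAt a i true)
      ≡⟨ cong (λ z → g (insertAt z i true)) (⊕-identityʳ a) ⟨
    g (insertAt (a ⊕ 𝟎) i (false xor true))
      ≡⟨ cong g (insertAt-⊕ a 𝟎 i false true) ⟩
    g (insertAt a i false ⊕ insertAt 𝟎 i true)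
      ≡⟨ g-add _ _ ⟩
    g (insertAt a i false) xor g (insertAt 𝟎 i true)
      ≡⟨ cong (g (insertAt a i false) xor_) (trans (cong g (insertAt-unit i)) gi) ⟩
    g (insertAt a i false) xor true ∎

  g-complete : ∀ a → g (complete a) ≡ false
  g-complete a = trans (g-insertAt a _) (xor-same (g (insertAt a i false)))

  complete-additive : Additive complete
  complete-additive x y = begin
    insertAt (x ⊕ y) i (g (insertAt (x ⊕ y) i false))
      ≡⟨ cong (insertAt (x ⊕ y) i) (trans (cong g (insertAt-⊕ x y i false false)) (g-add _ _)) ⟩
    insertAt (x ⊕ y) i (g (insertAt x i false) xor g (insertAt y i false))
      ≡⟨ insertAt-⊕ x y i _ _ ⟩
    complete x ⊕ complete y ∎

  complete-removeAt : ∀ a → g a ≡ false → complete (removeAt a i) ≡ a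
  complete-removeAt a ga = begin
    complete (removeAt a i)
      ≡⟨ cong (insertAt (removeAt a i) i) (xor-false (begin
           g (insertAt (removeAt a i) i false) xor lookup a i
             ≡⟨ g-insertAt _ (lookup a i) ⟨
           g (insertAt (removeAt a i) i (lookup a i))
             ≡⟨ cong g (insertAt-removeAt a i) ⟩
           g a
             ≡⟨ ga ⟩
           false ∎)) ⟩
    insertAt (removeAt a i) i (lookup a i)
      ≡⟨ insertAt-removeAt a i ⟩
    a ∎

  complete-injective : ∀ a → complete a ≡ 𝟎 → a ≡ 𝟎
  complete-injective a eq = begin
    a                                  ≡⟨ removeAt-insertAt a i _ ⟨
    removeAt (complete a) i            ≡⟨ cong (λ z → removeAt z i) (trans eq (sym (insertAt-𝟎 i))) ⟩
    removeAt (insertAt 𝟎 i false) i    ≡⟨ removeAt-insertAt 𝟎 i false ⟩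
    𝟎                                  ∎

head-⊕ : (x y : F (suc n)) → head (x ⊕ y) ≡ head x xor head y
head-⊕ (_ ∷ _) (_ ∷ _) = refl

tail-⊕ : (x y : F (suc n)) → tail (x ⊕ y) ≡ tail x ⊕ tail y
tail-⊕ (_ ∷ _) (_ ∷ _) = refl

-- If `f` vanished on all basis vectors it would vanish on `V`, contrary to `w`. So `f` is 1 on some
-- i-th basis vector, and the i-th coefficient can be eliminated by `complete`.
hyperplane : {V : Pred (F n) 0ℓ} (f : F n → Bool) → (∀ x y → f (x ⊕ y) ≡ f x xor f y) →
             (∃ λ w → w ∈ V × f w ≡ true) → Parametrisation V k →
             ∃ λ l → k ≡ suc l × Parametrisation (λ x → x ∈ V × f x ≡ false) l
hyperplane {k = k} {V} f f-add (w , w∈V , fw) p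
  with Fin.any? (λ i → f (Parametrisation.to p (unit i)) ≟ true)
... | no none = contradiction (trans (sym fw) fw≡false) λ ()
  where
  open Parametrisation p

  -- The bit is wrapped as a vector of length 1 so that `additive-ext` applies.
  vanishes : ∀ a → f (to a) ∷ [] ≡ 𝟎
  vanishes = additive-ext (λ x y → cong (_∷ []) (trans (cong f (additive x y)) (f-add _ _)))
                          (λ _ _ → refl)
                          (λ i → cong (_∷ []) (¬-not λ eq → none (i , eq)))

  fw≡false : f w ≡ false
  fw≡false = let a , eq = onto w∈V in trans (cong f (sym eq)) (∷-injectiveˡ (vanishes a))
hyperplane {k = suc l} {V} f f-add _ p | yes (i , gi) = l , refl , record
  { to        = λ a → to (complete′ a)
  ; additive  = ∘-additive {f = to} {complete′} additive (complete-additive g g-add i gi)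
  ; inside    = λ a → inside _ , g-complete g g-add i gi a
  ; onto      = λ (v∈V , fv) → let a , eq = onto v∈V in
      removeAt a i ,
      trans (cong to (complete-removeAt g g-add i gi a (trans (cong f eq) fv))) eq
  ; injective = λ a eq → complete-injective g g-add i gi a (injective _ eq)
  }
  where
  open Parametrisation p
  g = λ a → f (to a)

  g-add : ∀ x y → g (x ⊕ y) ≡ g x xor g y
  g-add x y = trans (cong f (additive x y)) (f-add _ _)

  complete′ = complete g g-add i gi

parametrisation-cong : {V W : Pred (F n) 0ℓ} → V ≐ W → Parametrisation V k → Parametrisation W k
parametrisation-cong (V⊆W , W⊆V) p = record
  { to = to ; additive = additive ; inside = λ a → V⊆W (inside a)
  ; onto = λ v∈W → onto (W⊆V v∈W) ; injective = injective }
  where open Parametrisation p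

-- Rank-nullity by induction on `m`: the coordinates of `T` are set to zero one at a time, each
-- lowering the dimension by one.
kernel-parametrisation : (T : F n → F m) → Additive T → (∀ z → ∃ λ x → T x ≡ z) →
                         ∃ λ k → n ≡ k + m × Parametrisation (λ x → T x ≡ 𝟎) k
kernel-parametrisation {n} {zero} T _ _ = n , sym (+-identityʳ n) , record
  { to = λ a → a ; additive = λ _ _ → refl ; inside = λ a → trivial (T a)
  ; onto = λ {v} _ → v , refl ; injective = λ _ eq → eq }
  where
  trivial : (z : F 0) → z ≡ 𝟎
  trivial [] = refl
kernel-parametrisation {n} {suc m} T T-add T-onto
  with k , n≡k+m , p ← kernel-parametrisation (λ x → tail (T x))
         (λ x y → trans (cong tail (T-add x y)) (tail-⊕ (T x) (T y)))
         (λ z → let x , eq = T-onto (false ∷ z) in x , cong tail eq)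
  with l , refl , q ← hyperplane (λ x → head (T x))
         (λ x y → trans (cong head (T-add x y)) (head-⊕ (T x) (T y)))
         -- A preimage of the first unit vector shows that the head of `T` is not zero on the kernel
         -- of the tail.
         (let x , eq = T-onto (true ∷ 𝟎) in x , cong tail eq , cong head eq) p
  = l , trans n≡k+m (sym (+-suc l m)) ,
    parametrisation-cong ((λ {x} (t , h) → cons (T x) h t) , λ eq → cong tail eq , cong head eq) q
  where
  cons : (z : F (suc m)) → head z ≡ false → tail z ≡ 𝟎 → z ≡ 𝟎
  cons (_ ∷ _) refl refl = refl

-- Single errors and Hamming balls of radius 1.

-- `nothing` means no error, so `Maybe (Fin n)` indexes all n + 1 points of a ball.
singleError : Maybe (Fin n) → F n
singleError = maybe′ unit 𝟎

distance-refl : (x : F n) → hammingDistance x x ≡ 0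
distance-refl []          = refl
distance-refl (false ∷ x) = distance-refl x
distance-refl (true ∷ x)  = distance-refl x

distance-unit : (x : F n) (i : Fin n) → hammingDistance x (x ⊕ unit i) ≡ 1
distance-unit (false ∷ x) zero    =
  cong suc (trans (cong (hammingDistance x) (⊕-identityʳ x)) (distance-refl x))
distance-unit (true ∷ x)  zero    =
  cong suc (trans (cong (hammingDistance x) (⊕-identityʳ x)) (distance-refl x))
distance-unit (false ∷ x) (suc i) = distance-unit x i
distance-unit (true ∷ x)  (suc i) = distance-unit x i

distance-singleError : (x : F n) (e : Maybe (Fin n)) → hammingDistance x (x ⊕ singleError e) ≤ 1
distance-singleError x nothing
  rewrite ⊕-identityʳ x | distance-refl x = z≤n
distance-singleError x (just i) rewrite distance-unit x i = s≤s z≤n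

distance≡0 : (x y : F n) → hammingDistance x y ≤ 0 → x ≡ y
distance≡0 []          []          _ = refl
distance≡0 (false ∷ x) (false ∷ y) d = cong (false ∷_) (distance≡0 x y d)
distance≡0 (true ∷ x)  (true ∷ y)  d = cong (true ∷_) (distance≡0 x y d)
distance≡0 (false ∷ x) (true ∷ y)  ()
distance≡0 (true ∷ x)  (false ∷ y) ()

distance≤1 : (x y : F n) → hammingDistance x y ≤ 1 → ∃ λ e → y ≡ x ⊕ singleError e
distance≤1 []      []      _ = nothing , refl
distance≤1 (b ∷ x) (c ∷ y) = step b c
  where
  same : ∀ b → hammingDistance x y ≤ 1 → ∃ λ e → b ∷ y ≡ (b ∷ x) ⊕ singleError e
  same b d with distance≤1 x y d
  ... | nothing , refl = nothing , cong₂ _∷_ (sym (xor-identityʳ b)) refl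
  ... | just i , refl  = just (suc i) , cong₂ _∷_ (sym (xor-identityʳ b)) refl

  step : ∀ b c → hammingDistance (b ∷ x) (c ∷ y) ≤ 1 → ∃ λ e → c ∷ y ≡ (b ∷ x) ⊕ singleError e
  step false false d       = same false d
  step true  true  d       = same true d
  step false true  (s≤s d) with refl ← distance≡0 x y d =
    just zero , cong (true ∷_) (sym (⊕-identityʳ x))
  step true  false (s≤s d) with refl ← distance≡0 x y d =
    just zero , cong (false ∷_) (sym (⊕-identityʳ x))

-- Propelinear perfect codes defined by syndromes.

column : (Fin n → F m) → Maybe (Fin n) → F m
column col = maybe′ col 𝟎

syndrome-singleError : (col : Fin n → F m) (e : Maybe (Fin n)) →
                       syndrome col (singleError e) ≡ column col e
syndrome-singleError col nothing  = additive-𝟎 (syndrome-additive col)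
syndrome-singleError col (just i) = syndrome-unit col i

-- A binary elementary abelian group V acts on the syndrome space by L, mapping columns to columns,
-- and d : V → F m is an injective crossed homomorphism for this action.
record PropelinearSyndromes (n m v : ℕ) : Set where
  field
    col           : Fin n → F m
    d             : F v → F m
    L             : F v → F m → F m
    col-injective : ∀ {i j} → col i ≡ col j → i ≡ j
    d-injective   : ∀ {u v} → d u ≡ d v → u ≡ v
    d-𝟎           : d 𝟎 ≡ 𝟎
    d-hom         : ∀ u v → d u ⊕ L u (d v) ≡ d (u ⊕ v)
    L-additive    : ∀ v → Additive (L v)
    L-𝟎           : ∀ z → L 𝟎 z ≡ z
    L-hom         : ∀ u v z → L u (L v z) ≡ L (u ⊕ v) z
    L-col         : ∀ v i → ∃ λ j → col j ≡ L v (col i)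
    correct       : ∀ z → ∃ λ e → ∃ λ v → z ⊕ column col e ≡ d v
    correct-unique : ∀ z e e′ {v v′} → z ⊕ column col e ≡ d v → z ⊕ column col e′ ≡ d v′ → e ≡ e′

  code : Code n
  code w = ∃ λ v → syndrome col w ≡ d v

  𝟎∈code : 𝟎 ∈ code
  𝟎∈code = 𝟎 , trans (additive-𝟎 (syndrome-additive col)) (sym d-𝟎)

  syndrome-error : ∀ x e → syndrome col (x ⊕ singleError e) ≡ syndrome col x ⊕ column col e
  syndrome-error x e = trans (syndrome-additive col x (singleError e))
    (cong (syndrome col x ⊕_) (syndrome-singleError col e))

  -- Whether a single error corrects `x` depends only on the syndrome of `x`, so `correct` yields
  -- existence and `correct-unique` uniqueness.
  perfect : Perfect code
  perfect x with e , v , eq ← correct (syndrome col x)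
    = x ⊕ singleError e , ((v , trans (syndrome-error x e) eq) , distance-singleError x e) , unique
    where
    unique : ∀ {y} → y ∈ code × hammingDistance x y ≤ 1 → x ⊕ singleError e ≡ y
    unique {y} ((v′ , y∈C) , close) with e′ , refl ← distance≤1 x y close =
      cong (λ e → x ⊕ singleError e)
           (correct-unique (syndrome col x) e e′ eq (trans (sym (syndrome-error x e′)) y∈C))

  α : F v → Fin n → Fin n
  α v i = proj₁ (L-col v i)

  col-α : ∀ v i → col (α v i) ≡ L v (col i)
  col-α v i = proj₂ (L-col v i)

  -- Distinct coordinates have distinct columns, so identities between the coordinate maps `α` can
  -- be tested on columns, where they become identities for `L`.
  α-hom : ∀ u v i → α u (α v i) ≡ α (u ⊕ v) i
  α-hom u v i = col-injective (begin
    col (α u (α v i))  ≡⟨ col-α u (α v i) ⟩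
    L u (col (α v i))  ≡⟨ cong (L u) (col-α v i) ⟩
    L u (L v (col i))  ≡⟨ L-hom u v (col i) ⟩
    L (u ⊕ v) (col i)  ≡⟨ col-α (u ⊕ v) i ⟨
    col (α (u ⊕ v) i)  ∎)

  α-𝟎 : ∀ i → α 𝟎 i ≡ i
  α-𝟎 i = col-injective (trans (col-α 𝟎 i) (L-𝟎 (col i)))

  α-involutive : ∀ v i → α v (α v i) ≡ i
  α-involutive v i = trans (α-hom v v i) (trans (cong (λ u → α u i) (⊕-same v)) (α-𝟎 i))

  ρ : F v → Permutation′ n
  ρ v = permutation (α v) (α v) (α-involutive v) (α-involutive v)

  -- The permutation is tied to the word: a codeword of syndrome `d v` is paired with `ρ v`. Since
  -- `d` is injective, each codeword occurs with exactly one permutation.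
  G : Pred (Transformation n) 0ℓ
  G (w , π) = ∃ λ v → syndrome col w ≡ d v × π Perm.≈ ρ v

  -- Permuting by `ρ u` applies `L u` to the syndrome, and adding `w` adds `d u`, so the crossed
  -- homomorphism law applies. This serves both for closure of `G` under composition and for
  -- invariance of the code.
  act : ∀ {w π u x v} → syndrome col w ≡ d u → π Perm.≈ ρ u → syndrome col x ≡ d v →
        syndrome col ((w , π) • x) ≡ d (u ⊕ v)
  act {w} {π} {u} {x} {v} w≡ π≈ x≡ = begin
    syndrome col (w ⊕ permute π x)
      ≡⟨ syndrome-additive col w (permute π x) ⟩
    syndrome col w ⊕ syndrome col (permute π x)
      ≡⟨ cong₂ _⊕_ w≡ (syndrome-permute col π (L-additive u)
                         (λ i → trans (cong col (π≈ i)) (col-α u i)) x) ⟩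
    d u ⊕ L u (syndrome col x)
      ≡⟨ cong (λ z → d u ⊕ L u z) x≡ ⟩
    d u ⊕ L u (d v)
      ≡⟨ d-hom u v ⟩
    d (u ⊕ v) ∎

  private module Aut = Group (AutF n)

  G-isSubgroup : IsSubgroup (AutF n) G
  G-isSubgroup = record
    { resp-≈    = λ { (refl , π≈π′) (v , w≡ , π≈) → v , w≡ , λ i → trans (sym (π≈π′ i)) (π≈ i) }
    ; ε-closed  = 𝟎 , proj₂ 𝟎∈code , λ i → sym (α-𝟎 i)
    ; ∙-closed  = λ { {_ , π} {_ , π′} (u , w≡ , π≈) (v , w′≡ , π′≈) →
        u ⊕ v , act {π = π} w≡ π≈ w′≡ ,
        λ i → trans (π≈ _) (trans (cong (α u) (π′≈ i)) (α-hom u v i)) }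
    ; ⁻¹-closed = λ { {w , π} (v , w≡ , π≈) → let π⁻¹≈ = inverse≈ {π} {v} π≈ in
        v , (begin
          syndrome col (permute (Perm.flip π) w)
            ≡⟨ syndrome-permute col (Perm.flip π) (L-additive v)
                 (λ i → trans (cong col (π⁻¹≈ i)) (col-α v i)) w ⟩
          L v (syndrome col w)
            ≡⟨ cong (L v) w≡ ⟩
          L v (d v)
            ≡⟨ L-d v ⟩
          d v ∎) , π⁻¹≈ }
    }
    where
    inverse≈ : ∀ {π v} → π Perm.≈ ρ v → Perm.flip π Perm.≈ ρ v
    inverse≈ {π} {v} π≈ i = begin
      π ⟨$⟩ˡ i                        ≡⟨ cong (π ⟨$⟩ˡ_) (α-involutive v i) ⟨
      π ⟨$⟩ˡ (α v (α v i))            ≡⟨ cong (π ⟨$⟩ˡ_) (π≈ (α v i)) ⟨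
      π ⟨$⟩ˡ (π ⟨$⟩ʳ (α v i))         ≡⟨ Perm.inverseˡ π ⟩
      α v i                           ∎

    -- The translation part of an inverse has syndrome `L v (d v)`; the law `d-hom` with both
    -- arguments `v` shows that it is again `d v`.
    L-d : ∀ v → L v (d v) ≡ d v
    L-d v = sym (⊕-zero (trans (d-hom v v) (trans (cong d (⊕-same v)) d-𝟎)))

  G-transitive : TransitiveOn G code
  G-transitive {x} {y} (u , x≡) (v , y≡) = g , g∈G , (begin
    g • x                    ≡⟨⟩
    (y ⊕ permute π x) ⊕ permute π x
                             ≡⟨ ⊕-assoc y _ _ ⟩
    y ⊕ (permute π x ⊕ permute π x)
                             ≡⟨ cong (y ⊕_) (⊕-same _) ⟩
    y ⊕ 𝟎                    ≡⟨ ⊕-identityʳ y ⟩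
    y                        ∎)
    where
    -- An element of index a moves syndrome `d u` to the one of index a + u, so reaching `d v` needs
    -- a = v + u; the word of `g` is then forced by `g • x ≡ y`.
    π = ρ (v ⊕ u)
    g = y ⊕ permute π x , π

    g∈G : g ∈ G
    g∈G = v ⊕ u , (begin
      syndrome col (y ⊕ permute π x)
        ≡⟨ syndrome-additive col y (permute π x) ⟩
      syndrome col y ⊕ syndrome col (permute π x)
        ≡⟨ cong₂ _⊕_ y≡ (trans (syndrome-permute col π (L-additive (v ⊕ u)) (col-α (v ⊕ u)) x)
                               (cong (L (v ⊕ u)) x≡)) ⟩
      d v ⊕ L (v ⊕ u) (d u)
        ≡⟨ cong (d v ⊕_) (⊕-swap (trans (d-hom (v ⊕ u) u) (cong d [v⊕u]⊕u≡v))) ⟩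
      d v ⊕ (d (v ⊕ u) ⊕ d v)
        ≡⟨ cong (d v ⊕_) (⊕-comm (d (v ⊕ u)) (d v)) ⟩
      d v ⊕ (d v ⊕ d (v ⊕ u))
        ≡⟨ ⊕-cancelˡ (d v) (d (v ⊕ u)) ⟩
      d (v ⊕ u) ∎) , λ _ → refl
      where
      [v⊕u]⊕u≡v : (v ⊕ u) ⊕ u ≡ v
      [v⊕u]⊕u≡v = trans (⊕-assoc v u u) (trans (cong (v ⊕_) (⊕-same u)) (⊕-identityʳ v))

  propelinear : Propelinear code
  propelinear = record
    { H          = G
    ; isSubgroup = G-isSubgroup
    ; H⊆Aut      = λ { {g} g∈G → stable {g} g∈G , λ {x} x∈C →
        (g ⁻¹) • x , stable {g ⁻¹} (⁻¹-closed {g} g∈G) (x , x∈C , refl) ,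
        (begin
          g • ((g ⁻¹) • x)  ≡⟨ •-assoc g (g ⁻¹) x ⟨
          (g ∙ g ⁻¹) • x    ≡⟨ cong₂ _⊕_ (proj₁ (Aut.inverseʳ g))
                                 (permute-cong {π = proj₂ (g ∙ g ⁻¹)} {Perm.id}
                                               (proj₂ (Aut.inverseʳ g)) x) ⟩
          (𝟎 , Perm.id) • x ≡⟨ •-identity x ⟩
          x                 ∎) }
    -- The bijection forgets the permutation, which `d-injective` recovers from the syndrome of the
    -- word.
    ; order      = record
      { to        = λ ((w , _) , v , w≡ , _) → w , v , w≡
      ; from      = λ (w , v , w≡) → (w , ρ v) , v , w≡ , λ _ → refl
      ; to-cong   = proj₁
      ; from-cong = λ { {_ , v , w≡} {_ , v′ , w≡′} refl →
          refl , λ i → cong (λ v → α v i) (d-injective (trans (sym w≡) w≡′)) }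
      ; inverse   = (λ { (refl , _) → refl })
                  , λ { {_ , v , w≡ , π≈} {_ , v′ , w≡′} refl →
          refl , λ i → trans (cong (λ v → α v i) (d-injective (trans (sym w≡′) w≡))) (sym (π≈ i)) }
      }
    ; transitive = G-transitive
    }
    where
    open Group (AutF n) using (_⁻¹)
    open IsSubgroup G-isSubgroup

    stable : ∀ {g} → g ∈ G → image (g •_) code ⊆ code
    stable {_ , π} (u , w≡ , π≈) (_ , (v , x≡) , refl) = u ⊕ v , act {π = π} w≡ π≈ x≡

  module _ (spanning : ∀ z → ∃ λ x → syndrome col x ≡ z)
           (rigid : ∀ v → (∀ u → ∃ λ u′ → d v ⊕ d u ≡ d u′) → v ≡ 𝟎) where

    -- As the zero word is in the code, so is `x`, with some syndrome `d v`. By `spanning` every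
    -- `d u` is the syndrome of a codeword, so adding `d v` maps the image of `d` into itself, and
    -- `rigid` applies. Only one inclusion is assumed because the covering words of a Mollard code
    -- come in that form.
    Ker⇒syndrome≡𝟎 : ∀ {x} → (∀ {w} → w ∈ code → x ⊕ w ∈ code) → syndrome col x ≡ 𝟎
    Ker⇒syndrome≡𝟎 {x} x+C⊆C
      with v , x≡ ← subst code (⊕-identityʳ x) (x+C⊆C 𝟎∈code)
      = trans x≡ (trans (cong d (rigid v shift)) d-𝟎)
      where
      shift : ∀ u → ∃ λ u′ → d v ⊕ d u ≡ d u′
      shift u with w , w≡ ← spanning (d u) with u′ , eq ← x+C⊆C (u , w≡) =
        u′ , trans (cong₂ _⊕_ (sym x≡) (sym w≡)) (trans (sym (syndrome-additive col x w)) eq)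

    Ker≐syndrome≡𝟎 : (λ x → syndrome col x ≡ 𝟎) ≐ Ker code
    Ker≐syndrome≡𝟎 =
      (λ {x} x≡ →
        (λ { (w , w∈C , refl) → translate x≡ w∈C }) ,
        λ {w} w∈C → x ⊕ w , translate x≡ w∈C , ⊕-cancelˡ x w) ,
      λ {x} (x+C⊆C , _) → Ker⇒syndrome≡𝟎 (λ {w} w∈C → x+C⊆C (w , w∈C , refl))
      where
      translate : ∀ {x w} → syndrome col x ≡ 𝟎 → w ∈ code → x ⊕ w ∈ code
      translate {x} {w} x≡ (v , w≡) = v ,
        trans (syndrome-additive col x w) (trans (cong₂ _⊕_ x≡ w≡) (⊕-identityˡ (d v)))

-- Quadratic forms, their shears and transvections.

infixr 7 _·_

_·_ : Bool → F n → F n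
b · x = if b then x else 𝟎

·-distribʳ : (b c : Bool) (x : F n) → (b xor c) · x ≡ b · x ⊕ c · x
·-distribʳ false c     x = sym (⊕-identityˡ (c · x))
·-distribʳ true  false x = sym (⊕-identityʳ x)
·-distribʳ true  true  x = sym (⊕-same x)

-- By `q-⊕` and bilinearity `q` is a quadratic form with polar form `β`; the last two fields make
-- `c` a singular vector of the radical, so that `q` and each `β v` are constant along `c`.
record QuadraticShear (r : ℕ) : Set where
  field
    c    : F r
    q    : F r → Bool
    β    : F r → F r → Bool
    q-⊕  : ∀ x y → q (x ⊕ y) ≡ q x xor (q y xor β x y)
    β-⊕ˡ : ∀ x y z → β (x ⊕ y) z ≡ β x z xor β y z
    β-⊕ʳ : ∀ x y z → β x (y ⊕ z) ≡ β x y xor β x z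
    q-c  : q c ≡ false
    β-c  : ∀ x → β x c ≡ false

  ψ : F r → F r
  ψ x = x ⊕ q x · c

  transvection : F r → F r → F r
  transvection v x = x ⊕ β v x · c

  β-𝟎ˡ : ∀ x → β 𝟎 x ≡ false
  β-𝟎ˡ x = begin
    β 𝟎 x                  ≡⟨ cong (λ z → β z x) (⊕-same x) ⟨
    β (x ⊕ x) x            ≡⟨ β-⊕ˡ x x x ⟩
    β x x xor β x x        ≡⟨ xor-same (β x x) ⟩
    false                  ∎

  q-𝟎 : q 𝟎 ≡ false
  q-𝟎 = begin
    q 𝟎                          ≡⟨ cong q (⊕-same 𝟎) ⟨
    q (𝟎 ⊕ 𝟎)                    ≡⟨ q-⊕ 𝟎 𝟎 ⟩
    q 𝟎 xor (q 𝟎 xor β 𝟎 𝟎)      ≡⟨ xor-assoc (q 𝟎) (q 𝟎) (β 𝟎 𝟎) ⟨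
    (q 𝟎 xor q 𝟎) xor β 𝟎 𝟎      ≡⟨ cong₂ _xor_ (xor-same (q 𝟎)) (β-𝟎ˡ 𝟎) ⟩
    false                        ∎

  β-invariant : ∀ x y b → β x (y ⊕ b · c) ≡ β x y
  β-invariant x y false = cong (β x) (⊕-identityʳ y)
  β-invariant x y true  = trans (β-⊕ʳ x y c) (trans (cong (β x y xor_) (β-c x)) (xor-identityʳ _))

  q-invariant : ∀ x b → q (x ⊕ b · c) ≡ q x
  q-invariant x false = cong q (⊕-identityʳ x)
  q-invariant x true  = begin
    q (x ⊕ c)                   ≡⟨ q-⊕ x c ⟩
    q x xor (q c xor β x c)     ≡⟨ cong₂ (λ a b → q x xor (a xor b)) q-c (β-c x) ⟩
    q x xor false               ≡⟨ xor-identityʳ (q x) ⟩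
    q x                         ∎

  ⊕-·-⊕-· : ∀ x a b → (x ⊕ a · c) ⊕ b · c ≡ x ⊕ (a xor b) · c
  ⊕-·-⊕-· x a b = trans (⊕-assoc x _ _) (cong (x ⊕_) (sym (·-distribʳ a b c)))

  ⊕-·-interchange : ∀ x y a b → (x ⊕ a · c) ⊕ (y ⊕ b · c) ≡ (x ⊕ y) ⊕ (a xor b) · c
  ⊕-·-interchange x y a b =
    trans (⊕-interchange x _ y _) (cong ((x ⊕ y) ⊕_) (sym (·-distribʳ a b c)))

  ψ-involutive : ∀ x → ψ (ψ x) ≡ x
  ψ-involutive x = begin
    ψ x ⊕ q (ψ x) · c        ≡⟨ cong (λ b → ψ x ⊕ b · c) (q-invariant x (q x)) ⟩
    ψ x ⊕ q x · c            ≡⟨ ⊕-·-⊕-· x (q x) (q x) ⟩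
    x ⊕ (q x xor q x) · c    ≡⟨ cong (λ b → x ⊕ b · c) (xor-same (q x)) ⟩
    x ⊕ 𝟎                    ≡⟨ ⊕-identityʳ x ⟩
    x                        ∎

  ψ-𝟎 : ψ 𝟎 ≡ 𝟎
  ψ-𝟎 = trans (⊕-identityˡ _) (cong (_· c) q-𝟎)

  -- The inner shears contribute q(x) + q(y) and the outer one q(x + y), all in direction `c`; their
  -- sum is the polar form.
  ψ-ψ⊕ψ : ∀ x y → ψ (ψ x ⊕ ψ y) ≡ (x ⊕ y) ⊕ β x y · c
  ψ-ψ⊕ψ x y = begin
    ψ (ψ x ⊕ ψ y)
      ≡⟨ cong ψ (⊕-·-interchange x y (q x) (q y)) ⟩
    ψ ((x ⊕ y) ⊕ (q x xor q y) · c)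
      ≡⟨ cong (λ b → ((x ⊕ y) ⊕ (q x xor q y) · c) ⊕ b · c)
              (trans (q-invariant (x ⊕ y) _) (q-⊕ x y)) ⟩
    ((x ⊕ y) ⊕ (q x xor q y) · c) ⊕ (q x xor (q y xor β x y)) · c
      ≡⟨ ⊕-·-⊕-· (x ⊕ y) _ _ ⟩
    (x ⊕ y) ⊕ ((q x xor q y) xor (q x xor (q y xor β x y))) · c
      ≡⟨ cong (λ b → (x ⊕ y) ⊕ b · c) (cancel (q x) (q y) (β x y)) ⟩
    (x ⊕ y) ⊕ β x y · c ∎
    where
    cancel : ∀ a b d → (a xor b) xor (a xor (b xor d)) ≡ d
    cancel = solve 3 (λ a b d → (a :+ b) :+ (a :+ (b :+ d)) := d) refl
      where open xor-∧-Solver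

  transvection-additive : ∀ v → Additive (transvection v)
  transvection-additive v x y = begin
    (x ⊕ y) ⊕ β v (x ⊕ y) · c          ≡⟨ cong (λ b → (x ⊕ y) ⊕ b · c) (β-⊕ʳ v x y) ⟩
    (x ⊕ y) ⊕ (β v x xor β v y) · c    ≡⟨ ⊕-·-interchange x y (β v x) (β v y) ⟨
    transvection v x ⊕ transvection v y ∎

  transvection-𝟎 : ∀ x → transvection 𝟎 x ≡ x
  transvection-𝟎 x = trans (cong (λ b → x ⊕ b · c) (β-𝟎ˡ x)) (⊕-identityʳ x)

  transvection-hom : ∀ u v x → transvection u (transvection v x) ≡ transvection (u ⊕ v) x
  transvection-hom u v x = begin
    transvection v x ⊕ β u (transvection v x) · c
      ≡⟨ cong (λ b → transvection v x ⊕ b · c) (β-invariant u x _) ⟩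
    transvection v x ⊕ β u x · c
      ≡⟨ ⊕-·-⊕-· x (β v x) (β u x) ⟩
    x ⊕ (β v x xor β u x) · c
      ≡⟨ cong (λ b → x ⊕ b · c) (trans (xor-comm (β v x) (β u x)) (sym (β-⊕ˡ u v x))) ⟩
    transvection (u ⊕ v) x ∎

  -- The transvection supplies exactly the polar term by which `q` fails to be additive, so `ψ` is a
  -- crossed homomorphism.
  ψ-hom : ∀ u v → ψ u ⊕ transvection u (ψ v) ≡ ψ (u ⊕ v)
  ψ-hom u v = begin
    ψ u ⊕ transvection u (ψ v)
      ≡⟨ cong (λ b → ψ u ⊕ (ψ v ⊕ b · c)) (β-invariant u v (q v)) ⟩
    ψ u ⊕ (ψ v ⊕ β u v · c)
      ≡⟨ cong (ψ u ⊕_) (⊕-·-⊕-· v (q v) (β u v)) ⟩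
    ψ u ⊕ (v ⊕ (q v xor β u v) · c)
      ≡⟨ ⊕-·-interchange u v (q u) (q v xor β u v) ⟩
    (u ⊕ v) ⊕ (q u xor (q v xor β u v)) · c
      ≡⟨ cong (λ b → (u ⊕ v) ⊕ b · c) (q-⊕ u v) ⟨
    ψ (u ⊕ v) ∎

module _ where
  open QuadraticShear

  -- u ↦ ψ (ψ u ⊕ ψ v) is the conjugate by the involution ψ of the translation by ψ v.
  Transverse : QuadraticShear r → QuadraticShear r → Set
  Transverse X Y = ∀ v → (∀ u → ψ X (ψ X u ⊕ ψ X v) ≡ ψ Y (ψ Y u ⊕ ψ Y v)) → v ≡ 𝟎

-- Two transverse shears in every dimension at least 3.

-- The form x₁x₂ + x₂x₃ + ... of the path graph; its polar form `pathPolar` is given by the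
-- adjacency matrix of the path.
path : F n → Bool
path []          = false
path (_ ∷ [])    = false
path (a ∷ b ∷ x) = (a ∧ b) xor path (b ∷ x)

pathPolar : F n → F n → Bool
pathPolar []          []            = false
pathPolar (_ ∷ [])    (_ ∷ [])      = false
pathPolar (a ∷ b ∷ x) (a′ ∷ b′ ∷ x′) = ((a ∧ b′) xor (b ∧ a′)) xor pathPolar (b ∷ x) (b′ ∷ x′)

path-⊕ : (x y : F n) → path (x ⊕ y) ≡ path x xor (path y xor pathPolar x y)
path-⊕ []          []            = refl
path-⊕ (_ ∷ [])    (_ ∷ [])      = refl
path-⊕ (a ∷ b ∷ x) (a′ ∷ b′ ∷ x′) = trans
  (cong (((a xor a′) ∧ (b xor b′)) xor_) (path-⊕ (b ∷ x) (b′ ∷ x′)))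
  (solve 7 (λ a b a′ b′ p p′ β → (a :+ a′) :* (b :+ b′) :+ (p :+ (p′ :+ β)) :=
      (a :* b :+ p) :+ ((a′ :* b′ :+ p′) :+ ((a :* b′ :+ b :* a′) :+ β)))
    refl a b a′ b′ (path (b ∷ x)) (path (b′ ∷ x′)) (pathPolar (b ∷ x) (b′ ∷ x′)))
  where open xor-∧-Solver

pathPolar-comm : (x y : F n) → pathPolar x y ≡ pathPolar y x
pathPolar-comm []          []            = refl
pathPolar-comm (_ ∷ [])    (_ ∷ [])      = refl
pathPolar-comm (a ∷ b ∷ x) (a′ ∷ b′ ∷ x′) = cong₂ _xor_
  (solve 4 (λ a b a′ b′ → a :* b′ :+ b :* a′ := a′ :* b :+ b′ :* a) refl a b a′ b′)
  (pathPolar-comm (b ∷ x) (b′ ∷ x′))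
  where open xor-∧-Solver

pathPolar-⊕ʳ : (x y z : F n) → pathPolar x (y ⊕ z) ≡ pathPolar x y xor pathPolar x z
pathPolar-⊕ʳ []          []            []              = refl
pathPolar-⊕ʳ (_ ∷ [])    (_ ∷ [])      (_ ∷ [])        = refl
pathPolar-⊕ʳ (a ∷ b ∷ x) (a′ ∷ b′ ∷ y) (a″ ∷ b″ ∷ z) = trans
  (cong (((a ∧ (b′ xor b″)) xor (b ∧ (a′ xor a″))) xor_) (pathPolar-⊕ʳ (b ∷ x) (b′ ∷ y) (b″ ∷ z)))
  (solve 8 (λ a b a′ b′ a″ b″ p p′ → (a :* (b′ :+ b″) :+ b :* (a′ :+ a″)) :+ (p :+ p′) :=
      ((a :* b′ :+ b :* a′) :+ p) :+ ((a :* b″ :+ b :* a″) :+ p′))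
    refl a b a′ b′ a″ b″ (pathPolar (b ∷ x) (b′ ∷ y)) (pathPolar (b ∷ x) (b″ ∷ z)))
  where open xor-∧-Solver

pathPolar-⊕ˡ : (x y z : F n) → pathPolar (x ⊕ y) z ≡ pathPolar x z xor pathPolar y z
pathPolar-⊕ˡ x y z = trans (pathPolar-comm (x ⊕ y) z)
  (trans (pathPolar-⊕ʳ z x y) (cong₂ _xor_ (pathPolar-comm z x) (pathPolar-comm z y)))

pathPolar-𝟎ˡ : (x : F n) → pathPolar 𝟎 x ≡ false
pathPolar-𝟎ˡ []          = refl
pathPolar-𝟎ˡ (_ ∷ [])    = refl
pathPolar-𝟎ˡ (_ ∷ b ∷ x) = pathPolar-𝟎ˡ (b ∷ x)

-- After a zero coordinate, pairing with the unit vector at that place reads off the next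
-- coordinate, so zeros propagate along the path. The leading zero matters: in odd length 1 0 1 ...
-- 0 1 is in the radical.
pathPolar-radical : (x : F n) → (∀ u → pathPolar u (false ∷ x) ≡ false) → x ≡ 𝟎
pathPolar-radical []      _      = refl
pathPolar-radical (b ∷ x) radical
  with refl ← trans (sym (trans (cong₂ _xor_ (xor-identityʳ b) (pathPolar-𝟎ˡ (b ∷ x)))
                                (xor-identityʳ b)))
                    (radical (true ∷ 𝟎))
  = cong (false ∷_) (pathPolar-radical x λ { (a ∷ u) →
      trans (cong (_xor pathPolar (a ∷ u) (false ∷ x)) (sym (∧-zeroʳ a))) (radical (false ∷ a ∷ u)) })

module _ (k : ℕ) where
  open QuadraticShear

  -- The path form runs over the coordinates from the second on, which leaves the first unit vector
  -- free to serve as `c`.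
  pathShear : QuadraticShear (3 + k)
  pathShear = record
    { c    = true ∷ 𝟎
    ; q    = λ { (_ ∷ x) → path x }
    ; β    = λ { (_ ∷ x) (_ ∷ y) → pathPolar x y }
    ; q-⊕  = λ { (_ ∷ x) (_ ∷ y) → path-⊕ x y }
    ; β-⊕ˡ = λ { (_ ∷ x) (_ ∷ y) (_ ∷ z) → pathPolar-⊕ˡ x y z }
    ; β-⊕ʳ = λ { (_ ∷ x) (_ ∷ y) (_ ∷ z) → pathPolar-⊕ʳ x y z }
    ; q-c  = path-𝟎 (2 + k)
    ; β-c  = λ { (_ ∷ x) → trans (pathPolar-comm x 𝟎) (pathPolar-𝟎ˡ x) }
    }
    where
    path-𝟎 : ∀ n → path {n} 𝟎 ≡ false
    path-𝟎 zero          = refl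
    path-𝟎 (suc zero)    = refl
    path-𝟎 (suc (suc n)) = path-𝟎 (suc n)

  -- The form x₁x₂, with radical x₁ = x₂ = 0; the third unit vector as `c` is where dimension at
  -- least 3 is used.
  planeShear : QuadraticShear (3 + k)
  planeShear = record
    { c    = false ∷ false ∷ true ∷ 𝟎
    ; q    = λ { (a ∷ b ∷ _) → a ∧ b }
    ; β    = λ { (a ∷ b ∷ _) (a′ ∷ b′ ∷ _) → (a ∧ b′) xor (b ∧ a′) }
    ; q-⊕  = λ { (a ∷ b ∷ _) (a′ ∷ b′ ∷ _) →
        solve 4 (λ a b a′ b′ → (a :+ a′) :* (b :+ b′) := a :* b :+ (a′ :* b′ :+ (a :* b′ :+ b :* a′)))
          refl a b a′ b′ }
    ; β-⊕ˡ = λ { (a ∷ b ∷ _) (a′ ∷ b′ ∷ _) (a″ ∷ b″ ∷ _) →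
        solve 6 (λ a b a′ b′ a″ b″ → (a :+ a′) :* b″ :+ (b :+ b′) :* a″ :=
            (a :* b″ :+ b :* a″) :+ (a′ :* b″ :+ b′ :* a″))
          refl a b a′ b′ a″ b″ }
    ; β-⊕ʳ = λ { (a ∷ b ∷ _) (a′ ∷ b′ ∷ _) (a″ ∷ b″ ∷ _) →
        solve 6 (λ a b a′ b′ a″ b″ → a :* (b′ :+ b″) :+ b :* (a′ :+ a″) :=
            (a :* b′ :+ b :* a′) :+ (a :* b″ :+ b :* a″))
          refl a b a′ b′ a″ b″ }
    ; q-c  = refl
    ; β-c  = λ { (a ∷ b ∷ _) → cong₂ _xor_ (∧-zeroʳ a) (∧-zeroʳ b) }
    }
    where open xor-∧-Solver

  -- The plane form kills the first two coordinates. The path form starts at the second one, so it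
  -- now meets a vector with leading zero.
  common-radical : ∀ v → (∀ u → β pathShear u v ≡ false) → (∀ u → β planeShear u v ≡ false) → v ≡ 𝟎
  common-radical (a ∷ b ∷ x) path-rad plane-rad
    with refl ← trans (sym (xor-identityʳ b)) (plane-rad (true ∷ false ∷ 𝟎))
       | refl ← plane-rad (false ∷ true ∷ 𝟎)
    = cong (λ x → false ∷ false ∷ x) (pathPolar-radical x λ u → path-rad (false ∷ u))

  -- By ψ-ψ⊕ψ the two sides are translates of u ⊕ v along the independent vectors c of the two shears.
  shears-agree : ∀ u v → ψ pathShear (ψ pathShear u ⊕ ψ pathShear v) ≡
                         ψ planeShear (ψ planeShear u ⊕ ψ planeShear v) →
                 β pathShear u v ≡ false × β planeShear u v ≡ false
  shears-agree u v eq = independent (β pathShear u v) (β planeShear u v)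
    (trans (⊕-swap (trans (sym (ψ-ψ⊕ψ pathShear u v)) (trans eq (ψ-ψ⊕ψ planeShear u v))))
           (⊕-cancelˡ (u ⊕ v) _))
    where
    independent : ∀ a b → a · c pathShear ≡ b · c planeShear → a ≡ false × b ≡ false
    independent false false _  = refl , refl
    independent false true  ()
    independent true  false ()
    independent true  true  ()

  shears-transverse : Transverse pathShear planeShear
  shears-transverse v agree = common-radical v (λ u → proj₁ (shears-agree u v (agree u)))
                                               (λ u → proj₂ (shears-agree u v (agree u)))

-- The concatenated code and its syndromes.

opaque
  -- A syndrome of a word (y | x): the parity of y, the Hamming syndrome of x, the Hamming syndrome
  -- of y.
  triple : Bool → F r → F r → F (1 + (r + r))
  triple b s t = b ∷ (s ++ t)

  triple-⊕ : ∀ b b′ (s s′ t t′ : F r) →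
             triple b s t ⊕ triple b′ s′ t′ ≡ triple (b xor b′) (s ⊕ s′) (t ⊕ t′)
  triple-⊕ b b′ s s′ t t′ = cong (_ ∷_) (++-⊕ s s′ t t′)

  triple-𝟎 : ∀ r → triple {r} false 𝟎 𝟎 ≡ 𝟎
  triple-𝟎 r = cong (false ∷_) (𝟎++𝟎 r)

  triple-injective : ∀ {b b′} {s s′ t t′ : F r} → triple b s t ≡ triple b′ s′ t′ →
                     b ≡ b′ × s ≡ s′ × t ≡ t′
  triple-injective {s = s} {s′} eq with b≡b′ , st≡ ← ∷-injective eq = b≡b′ , ++-injective s s′ st≡

  triple-surjective : ∀ r (z : F (1 + (r + r))) → ∃ λ b → ∃₂ λ (s t : F r) → z ≡ triple b s t
  triple-surjective r (b ∷ z) with s , t , refl ← splitAt r z = b , s , t , refl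

_≟ᵥ_ : DecidableEquality (F n)
_≟ᵥ_ = ≡-dec _≟_

module Construction {N r : ℕ} (points : Fin (suc N) ↔ F r) (X Y : QuadraticShear r)
                    (transverse : Transverse X Y) where

  private
    module X = QuadraticShear X
    module Y = QuadraticShear Y

  open Inverse points using (to; from) renaming (strictlyInverseˡ to to∘from; strictlyInverseʳ to from∘to)

  origin : Fin (suc N)
  origin = from 𝟎

  nonzero : Fin N → F r
  nonzero j = to (punchIn origin j)

  nonzero≢𝟎 : ∀ j → nonzero j ≢ 𝟎
  nonzero≢𝟎 j eq = punchInᵢ≢i origin j (trans (sym (from∘to _)) (cong from eq))

  evenPart : Fin (suc N) → Fin (suc N + N)
  evenPart i = i ↑ˡ N

  hammingPart : Fin N → Fin (suc N + N)
  hammingPart j = suc N ↑ʳ j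

  data Coordinate : Fin (suc N + N) → Set where
    even    : ∀ i → Coordinate (evenPart i)
    hamming : ∀ j → Coordinate (hammingPart j)

  coordinate : ∀ i → Coordinate i
  coordinate i with Fin.splitAt (suc N) i | join-splitAt (suc N) N i
  ... | inj₁ i | refl = even i
  ... | inj₂ j | refl = hamming j

  col : Fin (suc N + N) → F (1 + (r + r))
  col i = [ (λ i → triple true 𝟎 (to i)) , (λ j → triple false (nonzero j) 𝟎) ]′ (Fin.splitAt (suc N) i)

  col-even : ∀ i → col (evenPart i) ≡ triple true 𝟎 (to i)
  col-even i = cong [ _ , _ ]′ (splitAt-↑ˡ (suc N) i N)

  col-hamming : ∀ j → col (hammingPart j) ≡ triple false (nonzero j) 𝟎
  col-hamming j = cong [ _ , _ ]′ (splitAt-↑ʳ (suc N) N j)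

  -- A uniform description of the columns together with the zero syndrome of no error: the zero
  -- vector, missing in the Hamming part, appears as `columnAt false 𝟎`.
  columnAt : Bool → F r → F (1 + (r + r))
  columnAt true  v = triple true 𝟎 v
  columnAt false v = triple false v 𝟎

  columnAt-injective : ∀ {b b′ v v′} → columnAt b v ≡ columnAt b′ v′ → b ≡ b′ × v ≡ v′
  columnAt-injective {false} {false} eq = let b , s , _ = triple-injective eq in b , s
  columnAt-injective {true}  {true}  eq = let b , _ , t = triple-injective eq in b , t
  columnAt-injective {false} {true}  eq = contradiction (proj₁ (triple-injective eq)) λ ()
  columnAt-injective {true}  {false} eq = contradiction (proj₁ (triple-injective eq)) λ ()

  locate : Bool → F r → Maybe (Fin (suc N + N))
  locate true  v = just (evenPart (from v))
  locate false v with v ≟ᵥ 𝟎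
  ... | yes _   = nothing
  ... | no v≢𝟎 = just (hammingPart (punchOut {i = origin} {from v} λ eq →
                    v≢𝟎 (trans (sym (to∘from v)) (trans (cong to (sym eq)) (to∘from 𝟎)))))

  column-locate : ∀ b v → column col (locate b v) ≡ columnAt b v
  column-locate true  v = trans (col-even (from v)) (cong (triple true 𝟎) (to∘from v))
  column-locate false v with v ≟ᵥ 𝟎
  ... | yes refl = sym (triple-𝟎 r)
  ... | no v≢𝟎  = trans (col-hamming _)
    (cong (λ s → triple false s 𝟎) (trans (cong to (punchIn-punchOut _)) (to∘from v)))

  locate-onto : ∀ e → ∃₂ λ b v → locate b v ≡ e
  locate-onto nothing = false , 𝟎 , locate-𝟎
    where
    locate-𝟎 : locate false 𝟎 ≡ nothing
    locate-𝟎 with 𝟎 {r} ≟ᵥ 𝟎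
    ... | yes _   = refl
    ... | no 𝟎≢𝟎 = contradiction refl 𝟎≢𝟎
  locate-onto (just i) with coordinate i
  ... | even i    = true , to i , cong (λ i → just (evenPart i)) (from∘to i)
  ... | hamming j = false , nonzero j , locate-nonzero
    where
    locate-nonzero : locate false (nonzero j) ≡ just (hammingPart j)
    locate-nonzero with nonzero j ≟ᵥ 𝟎
    ... | yes eq = contradiction eq (nonzero≢𝟎 j)
    ... | no _   = cong (λ j → just (hammingPart j))
      (punchIn-injective origin _ _ (trans (punchIn-punchOut _) (from∘to _)))

  column-injective : ∀ {e e′} → column col e ≡ column col e′ → e ≡ e′
  column-injective {e} {e′} eq
    with b , v , refl ← locate-onto e | b′ , v′ , refl ← locate-onto e′
    with refl , refl ← columnAt-injective {b} {b′}
           (trans (sym (column-locate b v)) (trans eq (column-locate b′ v′)))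
    = refl

  d : F r → F (1 + (r + r))
  d v = triple false (X.ψ v) (Y.ψ v)

  opaque
    L : F r → F (1 + (r + r)) → F (1 + (r + r))
    L v z = let b , s , t , _ = triple-surjective r z in
      triple b (X.transvection v s) (Y.transvection v t)

    L-triple : ∀ v b s t → L v (triple b s t) ≡ triple b (X.transvection v s) (Y.transvection v t)
    L-triple v b s t with _ , _ , _ , eq ← triple-surjective r (triple b s t)
      with refl , refl , refl ← triple-injective eq = refl

  L-𝟎 : ∀ z → L 𝟎 z ≡ z
  L-𝟎 z with b , s , t , refl ← triple-surjective r z =
    trans (L-triple 𝟎 b s t) (cong₂ (triple b) (X.transvection-𝟎 s) (Y.transvection-𝟎 t))

  L-hom : ∀ u v z → L u (L v z) ≡ L (u ⊕ v) z
  L-hom u v z with b , s , t , refl ← triple-surjective r z = begin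
    L u (L v (triple b s t))
      ≡⟨ cong (L u) (L-triple v b s t) ⟩
    L u (triple b (X.transvection v s) (Y.transvection v t))
      ≡⟨ L-triple u b _ _ ⟩
    triple b (X.transvection u (X.transvection v s)) (Y.transvection u (Y.transvection v t))
      ≡⟨ cong₂ (triple b) (X.transvection-hom u v s) (Y.transvection-hom u v t) ⟩
    triple b (X.transvection (u ⊕ v) s) (Y.transvection (u ⊕ v) t)
      ≡⟨ L-triple (u ⊕ v) b s t ⟨
    L (u ⊕ v) (triple b s t) ∎

  L-additive : ∀ v → Additive (L v)
  L-additive v z z′
    with b , s , t , refl ← triple-surjective r z | b′ , s′ , t′ , refl ← triple-surjective r z′
    = begin
    L v (triple b s t ⊕ triple b′ s′ t′)
      ≡⟨ cong (L v) (triple-⊕ b b′ s s′ t t′) ⟩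
    L v (triple (b xor b′) (s ⊕ s′) (t ⊕ t′))
      ≡⟨ L-triple v _ _ _ ⟩
    triple (b xor b′) (X.transvection v (s ⊕ s′)) (Y.transvection v (t ⊕ t′))
      ≡⟨ cong₂ (triple (b xor b′)) (X.transvection-additive v s s′) (Y.transvection-additive v t t′) ⟩
    triple (b xor b′) (X.transvection v s ⊕ X.transvection v s′)
                      (Y.transvection v t ⊕ Y.transvection v t′)
      ≡⟨ triple-⊕ b b′ _ _ _ _ ⟨
    triple b (X.transvection v s) (Y.transvection v t) ⊕
    triple b′ (X.transvection v s′) (Y.transvection v t′)
      ≡⟨ cong₂ _⊕_ (L-triple v b s t) (L-triple v b′ s′ t′) ⟨
    L v (triple b s t) ⊕ L v (triple b′ s′ t′) ∎

  L-columnAt : ∀ v b u → ∃ λ u′ → L v (columnAt b u) ≡ columnAt b u′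
  L-columnAt v true  u = Y.transvection v u ,
    trans (L-triple v true 𝟎 u) (cong (λ s → triple true s (Y.transvection v u))
      (additive-𝟎 (X.transvection-additive v)))
  L-columnAt v false u = X.transvection v u ,
    trans (L-triple v false u 𝟎) (cong (triple false (X.transvection v u))
      (additive-𝟎 (Y.transvection-additive v)))

  -- Transvections preserve the two kinds of columns, and `L v`, an involution, cannot send a column
  -- to the zero syndrome, so `locate` does not return `nothing`.
  L-col : ∀ v i → ∃ λ j → col j ≡ L v (col i)
  L-col v i with b , u , eq ← locate-onto (just i) with u′ , Lu≡ ← L-columnAt v b u
    with locate b u′ | column-locate b u′
  ... | just j  | eq′ = j , trans eq′ (trans (sym Lu≡)
                          (cong (L v) (trans (sym (column-locate b u)) (cong (column col) eq))))
  ... | nothing | eq′ = contradiction (column-injective {just i} {nothing} (begin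
      col i                      ≡⟨ cong (column col) eq ⟨
      column col (locate b u)    ≡⟨ column-locate b u ⟩
      columnAt b u               ≡⟨ L-𝟎 _ ⟨
      L 𝟎 (columnAt b u)         ≡⟨ cong (λ w → L w (columnAt b u)) (⊕-same v) ⟨
      L (v ⊕ v) (columnAt b u)   ≡⟨ L-hom v v _ ⟨
      L v (L v (columnAt b u))   ≡⟨ cong (L v) (trans Lu≡ (sym eq′)) ⟩
      L v 𝟎                      ≡⟨ additive-𝟎 (L-additive v) ⟩
      𝟎                          ∎)) λ ()

  -- The parity bit tells which half carries the error. The other half is correct and determines v,
  -- because `ψ` is an involution, and v determines what the faulty half should be.
  decode : Bool → F r → F r → F r
  decode false s t = s ⊕ X.ψ (Y.ψ t)
  decode true  s t = t ⊕ Y.ψ (X.ψ s)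

  decode-correct : ∀ b s t → ∃ λ v → triple b s t ⊕ columnAt b (decode b s t) ≡ d v
  decode-correct false s t = Y.ψ t , trans (triple-⊕ false false s _ t 𝟎)
    (cong₂ (triple false) (⊕-cancelˡ s _) (trans (⊕-identityʳ t) (sym (Y.ψ-involutive t))))
  decode-correct true  s t = X.ψ s , trans (triple-⊕ true true s 𝟎 t _)
    (cong₂ (triple false) (trans (⊕-identityʳ s) (sym (X.ψ-involutive s))) (⊕-cancelˡ t _))

  -- The components are read in turn: parity gives `b′`, the half without error gives `v`, the
  -- remaining half gives `w`.
  decode-unique : ∀ b s t b′ w {v} → triple b s t ⊕ columnAt b′ w ≡ d v → b ≡ b′ × w ≡ decode b s t
  decode-unique b s t false w {v} eq
    with b≡ , s≡ , t≡ ← triple-injective (trans (sym (triple-⊕ b false s w t 𝟎)) eq)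
    with refl ← trans (sym (xor-identityʳ b)) b≡
    = refl , trans (⊕-swap s≡) (cong (λ v → s ⊕ X.ψ v)
        (trans (sym (Y.ψ-involutive v)) (cong Y.ψ (trans (sym t≡) (⊕-identityʳ t)))))
  decode-unique b s t true w {v} eq
    with b≡ , s≡ , t≡ ← triple-injective (trans (sym (triple-⊕ b true s 𝟎 t w)) eq)
    with refl ← xor-false {b} {true} b≡
    = refl , trans (⊕-swap t≡) (cong (λ v → t ⊕ Y.ψ v)
        (trans (sym (X.ψ-involutive v)) (cong X.ψ (trans (sym s≡) (⊕-identityʳ s)))))

  correct : ∀ z → ∃ λ e → ∃ λ v → z ⊕ column col e ≡ d v
  correct z with b , s , t , refl ← triple-surjective r z with v , eq ← decode-correct b s t =
    locate b (decode b s t) , v , trans (cong (triple b s t ⊕_) (column-locate b _)) eq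

  correct-unique : ∀ z e e′ {v v′} → z ⊕ column col e ≡ d v → z ⊕ column col e′ ≡ d v′ → e ≡ e′
  correct-unique z e e′ {v} {v′} eq eq′
    with c , s , t , refl ← triple-surjective r z
    with b , w , refl ← locate-onto e | b′ , w′ , refl ← locate-onto e′
    with refl , refl ← decode-unique c s t b w {v}
           (trans (cong (triple c s t ⊕_) (sym (column-locate b w))) eq)
       | refl , refl ← decode-unique c s t b′ w′ {v′}
           (trans (cong (triple c s t ⊕_) (sym (column-locate b′ w′))) eq′)
    = refl

  syndromes : PropelinearSyndromes (suc N + N) (1 + (r + r)) r
  syndromes = record
    { col = col ; d = d ; L = L
    ; col-injective = λ eq → just-injective (column-injective eq)
    ; d-injective = λ {u} {v} eq → trans (sym (X.ψ-involutive u))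
        (trans (cong X.ψ (proj₁ (proj₂ (triple-injective eq)))) (X.ψ-involutive v))
    ; d-𝟎 = trans (cong₂ (triple false) X.ψ-𝟎 Y.ψ-𝟎) (triple-𝟎 r)
    ; d-hom = λ u v → trans (cong (d u ⊕_) (L-triple u false _ _))
        (trans (triple-⊕ false false (X.ψ u) _ (Y.ψ u) _)
               (cong₂ (triple false) (X.ψ-hom u v) (Y.ψ-hom u v)))
    ; L-additive = L-additive
    ; L-𝟎 = L-𝟎
    ; L-hom = L-hom
    ; L-col = L-col
    ; correct = correct
    ; correct-unique = correct-unique
    }

  private
    Reachable : F (1 + (r + r)) → Set
    Reachable z = ∃ λ x → syndrome col x ≡ z

    columnAt-reachable : ∀ b v → Reachable (columnAt b v)
    columnAt-reachable b v = singleError (locate b v) ,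
      trans (syndrome-singleError col (locate b v)) (column-locate b v)

    ⊕-reachable : ∀ {z z′} → Reachable z → Reachable z′ → Reachable (z ⊕ z′)
    ⊕-reachable (x , x≡) (x′ , x′≡) = x ⊕ x′ , trans (syndrome-additive col x x′) (cong₂ _⊕_ x≡ x′≡)

    half-reachable : ∀ b (t : F r) → Reachable (triple b 𝟎 t)
    half-reachable true  t = columnAt-reachable true t
    -- Adding the even column at the zero vector cancels the parity bit and leaves `t` unchanged.
    half-reachable false t = subst Reachable
      (trans (triple-⊕ true true 𝟎 𝟎 t 𝟎) (cong₂ (triple false) (⊕-same 𝟎) (⊕-identityʳ t)))
      (⊕-reachable (columnAt-reachable true t) (columnAt-reachable true 𝟎))

  spanning : ∀ z → ∃ λ x → syndrome col x ≡ z
  spanning z with b , s , t , refl ← triple-surjective r z = subst Reachable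
    (trans (triple-⊕ false b s 𝟎 𝟎 t) (cong₂ (triple b) (⊕-identityʳ s) (⊕-identityˡ t)))
    (⊕-reachable (columnAt-reachable false s) (half-reachable b t))

  -- From d v + d u = d u′, both sides in `Transverse` evaluate to u′, as each `ψ` undoes itself.
  rigid : ∀ v → (∀ u → ∃ λ u′ → d v ⊕ d u ≡ d u′) → v ≡ 𝟎
  rigid v shift = transverse v λ u →
    let u′ , eq = shift u
        _ , x≡ , y≡ = triple-injective (trans (sym (triple-⊕ false false (X.ψ v) _ (Y.ψ v) _)) eq)
    in trans (cong X.ψ (trans (⊕-comm (X.ψ u) (X.ψ v)) x≡)) (trans (X.ψ-involutive u′)
      (sym (trans (cong Y.ψ (trans (⊕-comm (Y.ψ u) (Y.ψ v)) y≡)) (Y.ψ-involutive u′))))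

-- Words of weight 3 preserving a Mollard code, and their transport along equivalences.

unit-↑ˡ : (i : Fin m) (n : ℕ) → unit (i ↑ˡ n) ≡ unit i ++ 𝟎
unit-↑ˡ {suc m} zero    n = cong (true ∷_) (sym (𝟎++𝟎 m))
unit-↑ˡ         (suc i) n = cong (false ∷_) (unit-↑ˡ i n)

unit-↑ʳ : (m : ℕ) (i : Fin n) → unit (m ↑ʳ i) ≡ 𝟎 ++ unit i
unit-↑ʳ zero    i = refl
unit-↑ʳ (suc m) i = cong (false ∷_) (unit-↑ʳ m i)

lookup-unit-combine : (i i′ : Fin t) (j j′ : Fin m) →
  lookup (unit (combine i j)) (combine i′ j′) ≡ lookup (unit i) i′ ∧ lookup (unit j) j′
lookup-unit-combine i i′ j j′ with i Fin.≟ i′ | j Fin.≟ j′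
... | yes refl | yes refl = trans (lookup-unit (combine i j))
  (sym (cong₂ _∧_ (lookup-unit i) (lookup-unit j)))
... | no i≢i′  | _ = trans (lookup-unit-≢ λ eq → i≢i′ (combine-injectiveˡ i j i′ j′ eq))
  (sym (cong (_∧ _) (lookup-unit-≢ i≢i′)))
... | yes _    | no j≢j′ = trans (lookup-unit-≢ λ eq → j≢j′ (combine-injectiveʳ i j i′ j′ eq))
  (sym (trans (cong (_ ∧_) (lookup-unit-≢ j≢j′)) (∧-zeroʳ _)))

module MollardWords (t m : ℕ) where

  private
    P₁ = p₁ {t} {m}
    P₂ = p₂ {t} {m}
    Z′ = Z {t} {m}

    index : Fin t → Fin m → Fin (t * m)
    index = combine

  p₁-additive : Additive P₁
  p₁-additive x y = lookup-ext λ i → begin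
    lookup (P₁ (x ⊕ y)) i
      ≡⟨ lookup∘tabulate _ i ⟩
    sum (λ j → lookup (x ⊕ y) (index i j))
      ≡⟨ sum-cong-≗ (λ j → lookup-zipWith _xor_ (index i j) x y) ⟩
    sum (λ j → lookup x (index i j) xor lookup y (index i j))
      ≡⟨ ∑-distrib-+ (λ j → lookup x (index i j)) (λ j → lookup y (index i j)) ⟩
    sum (λ j → lookup x (index i j)) xor sum (λ j → lookup y (index i j))
      ≡⟨ cong₂ _xor_ (lookup∘tabulate _ i) (lookup∘tabulate _ i) ⟨
    lookup (P₁ x) i xor lookup (P₁ y) i
      ≡⟨ lookup-zipWith _xor_ i (P₁ x) (P₁ y) ⟨
    lookup (P₁ x ⊕ P₁ y) i ∎

  p₂-additive : Additive P₂
  p₂-additive x y = lookup-ext λ j → begin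
    lookup (P₂ (x ⊕ y)) j
      ≡⟨ lookup∘tabulate _ j ⟩
    sum (λ i → lookup (x ⊕ y) (index i j))
      ≡⟨ sum-cong-≗ (λ i → lookup-zipWith _xor_ (index i j) x y) ⟩
    sum (λ i → lookup x (index i j) xor lookup y (index i j))
      ≡⟨ ∑-distrib-+ (λ i → lookup x (index i j)) (λ i → lookup y (index i j)) ⟩
    sum (λ i → lookup x (index i j)) xor sum (λ i → lookup y (index i j))
      ≡⟨ cong₂ _xor_ (lookup∘tabulate _ j) (lookup∘tabulate _ j) ⟨
    lookup (P₂ x) j xor lookup (P₂ y) j
      ≡⟨ lookup-zipWith _xor_ j (P₂ x) (P₂ y) ⟨
    lookup (P₂ x ⊕ P₂ y) j ∎

  p₁-unit : ∀ i j → P₁ (unit (index i j)) ≡ unit i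
  p₁-unit i j = lookup-ext λ i′ → begin
    lookup (P₁ (unit (index i j))) i′
      ≡⟨ lookup∘tabulate _ i′ ⟩
    sum (λ j′ → lookup (unit (index i j)) (index i′ j′))
      ≡⟨ sum-cong-≗ (λ j′ → trans (lookup-unit-combine i i′ j j′) (∧-comm (lookup (unit i) i′) _)) ⟩
    sum (λ j′ → lookup (unit j) j′ ∧ lookup (unit i) i′)
      ≡⟨ sum-unit j (λ _ → lookup (unit i) i′) ⟩
    lookup (unit i) i′ ∎

  p₂-unit : ∀ i j → P₂ (unit (index i j)) ≡ unit j
  p₂-unit i j = lookup-ext λ j′ → begin
    lookup (P₂ (unit (index i j))) j′
      ≡⟨ lookup∘tabulate _ j′ ⟩
    sum (λ i′ → lookup (unit (index i j)) (index i′ j′))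
      ≡⟨ sum-cong-≗ (λ i′ → lookup-unit-combine i i′ j j′) ⟩
    sum (λ i′ → lookup (unit i) i′ ∧ lookup (unit j) j′)
      ≡⟨ sum-unit i (λ _ → lookup (unit j) j′) ⟩
    lookup (unit j) j′ ∎

  Z-⊕ : ∀ {u v} → u ∈ Z′ → v ∈ Z′ → u ⊕ v ∈ Z′
  Z-⊕ (x , refl) (y , refl) = x ⊕ y , (begin
    ((x ++ P₁ x) ++ P₂ x) ⊕ ((y ++ P₁ y) ++ P₂ y)
      ≡⟨ ++-⊕ (x ++ P₁ x) (y ++ P₁ y) (P₂ x) (P₂ y) ⟩
    ((x ++ P₁ x) ⊕ (y ++ P₁ y)) ++ (P₂ x ⊕ P₂ y)
      ≡⟨ cong₂ _++_ (trans (++-⊕ x y (P₁ x) (P₁ y)) (cong ((x ⊕ y) ++_) (sym (p₁-additive x y))))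
                    (sym (p₂-additive x y)) ⟩
    ((x ⊕ y) ++ P₁ (x ⊕ y)) ++ P₂ (x ⊕ y) ∎)

  cell : Fin t → Fin m → Fin (t * m + t + m)
  cell i j = (index i j ↑ˡ t) ↑ˡ m

  row : Fin t → Fin (t * m + t + m)
  row i = (t * m ↑ʳ i) ↑ˡ m

  col : Fin m → Fin (t * m + t + m)
  col j = (t * m + t) ↑ʳ j

  unit-cell : ∀ i j → unit (cell i j) ≡ (unit (index i j) ++ 𝟎) ++ 𝟎
  unit-cell i j = trans (unit-↑ˡ (index i j ↑ˡ t) m) (cong (_++ 𝟎) (unit-↑ˡ (index i j) t))

  unit-row : ∀ i → unit (row i) ≡ (𝟎 {t * m} ++ unit i) ++ 𝟎
  unit-row i = trans (unit-↑ˡ (t * m ↑ʳ i) m) (cong (_++ 𝟎) (unit-↑ʳ (t * m) i))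

  unit-col : ∀ j → unit (col j) ≡ (𝟎 {t * m} ++ 𝟎 {t}) ++ unit j
  unit-col j = trans (unit-↑ʳ (t * m + t) j) (cong (_++ unit j) (sym (𝟎++𝟎 (t * m))))

  -- This is the element of `Z` belonging to the unit vector at (i, j), whose row and column sums
  -- are again unit vectors.
  triangle∈Z : ∀ i j → unit (cell i j) ⊕ (unit (row i) ⊕ unit (col j)) ∈ Z′
  triangle∈Z i j = x , (begin
    unit (cell i j) ⊕ (unit (row i) ⊕ unit (col j))
      ≡⟨ cong₂ _⊕_ (unit-cell i j) (cong₂ _⊕_ (unit-row i) (unit-col j)) ⟩
    ((x ++ 𝟎) ++ 𝟎) ⊕ (((𝟎 {t * m} ++ unit i) ++ 𝟎) ⊕ ((𝟎 {t * m} ++ 𝟎) ++ unit j))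
      ≡⟨ blocks (x ++ 𝟎) 𝟎 (𝟎 {t * m} ++ unit i) 𝟎 (𝟎 {t * m} ++ 𝟎) (unit j) ⟩
    ((x ++ 𝟎) ⊕ ((𝟎 {t * m} ++ unit i) ⊕ (𝟎 {t * m} ++ 𝟎))) ++ (𝟎 ⊕ (𝟎 ⊕ unit j))
      ≡⟨ cong₂ _++_ (trans (blocks x 𝟎 𝟎 (unit i) 𝟎 𝟎)
           (cong₂ _++_ (trans (cong (x ⊕_) (⊕-identityʳ 𝟎)) (⊕-identityʳ x))
                       (trans (⊕-identityˡ _) (⊕-identityʳ (unit i)))))
           (trans (⊕-identityˡ _) (⊕-identityˡ (unit j))) ⟩
    (x ++ unit i) ++ unit j
      ≡⟨ cong₂ (λ y z → (x ++ y) ++ z) (p₁-unit i j) (p₂-unit i j) ⟨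
    (x ++ P₁ x) ++ P₂ x ∎)
    where
    x = unit (index i j)

    blocks : ∀ {k l} (a : F k) (b : F l) a′ b′ a″ b″ →
             (a ++ b) ⊕ ((a′ ++ b′) ⊕ (a″ ++ b″)) ≡ (a ⊕ (a′ ⊕ a″)) ++ (b ⊕ (b′ ⊕ b″))
    blocks a b a′ b′ a″ b″ = trans (cong ((a ++ b) ⊕_) (++-⊕ a′ a″ b′ b″)) (++-⊕ a (a′ ⊕ a″) b (b′ ⊕ b″))

  data Position : Fin (t * m + t + m) → Set where
    is-cell : ∀ i j → Position (cell i j)
    is-row  : ∀ i → Position (row i)
    is-col  : ∀ j → Position (col j)

  position : ∀ k → Position k
  position k with Fin.splitAt (t * m + t) k | join-splitAt (t * m + t) m k
  ... | inj₂ j | refl = is-col j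
  ... | inj₁ l | refl with Fin.splitAt (t * m) l | join-splitAt (t * m) t l
  ...   | inj₂ i | refl = is-row i
  ...   | inj₁ p | refl = subst (λ p → Position ((p ↑ˡ t) ↑ˡ m)) (combine-remQuot {t} m p)
    (uncurry is-cell (remQuot {t} m p))

-- Every coordinate lies on a vector e_k + e_a + e_b (of weight 3 or 1) preserving the code.
CoveredByTriangles : Code n → Set
CoveredByTriangles C =
  ∀ k → ∃₂ λ a b → ∀ {w} → w ∈ C → (unit k ⊕ (unit a ⊕ unit b)) ⊕ w ∈ C

-- `Z` is closed under addition, so its elements preserve the code. A row or column coordinate lies
-- on a triangle as soon as it has a partner, here the one with index 0, which exists because both
-- lengths are positive.
mollard-covered : {M : Code n} → IsMollard M → CoveredByTriangles M
mollard-covered (mollard {zero} ⦃ () ⦄ _ _ _ _ _)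
mollard-covered (mollard {suc _} {zero} ⦃ _ ⦄ ⦃ () ⦄ _ _ _ _ _)
mollard-covered (mollard {t@(suc _)} {m@(suc _)} {C} {D} _ _ _ _ f) k = cover (position k)
  where
  open MollardWords t m
  M = Mollard C D f

  stable : ∀ {z} → z ∈ Z {t} {m} → ∀ {w} → w ∈ M → z ⊕ w ∈ M
  stable {z} z∈Z (y , y∈C , x , x∈D , u , u∈Z , refl) =
    y , y∈C , x , x∈D , z ⊕ u , Z-⊕ z∈Z u∈Z , ⊕-leftComm z _ u

  cover : ∀ {k} → Position k → ∃₂ λ a b → ∀ {w} → w ∈ M → (unit k ⊕ (unit a ⊕ unit b)) ⊕ w ∈ M
  cover (is-cell i j) = row i , col j , stable (triangle∈Z i j)
  cover (is-row i)    = cell i zero , col zero ,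
    stable (subst (_∈ Z {t} {m}) (⊕-leftComm (unit (cell i zero)) (unit (row i)) (unit (col zero)))
      (triangle∈Z i zero))
  cover (is-col j)    = cell zero j , row zero ,
    stable (subst (_∈ Z {t} {m}) (rotate (unit (cell zero j)) (unit (row zero)) (unit (col j)))
      (triangle∈Z zero j))
    where
    rotate : ∀ {n} (x y z : F n) → x ⊕ (y ⊕ z) ≡ z ⊕ (x ⊕ y)
    rotate x y z = trans (sym (⊕-assoc x y z)) (⊕-comm (x ⊕ y) z)

permute-injective : (π : Permutation′ n) {x y : F n} → permute π x ≡ permute π y → x ≡ y
permute-injective π {x} {y} eq = lookup-ext λ i → trans (sym (entry x i))
  (trans (cong (λ z → lookup z (π ⟨$⟩ʳ i)) eq) (entry y i))
  where
  entry : ∀ z i → lookup (permute π z) (π ⟨$⟩ʳ i) ≡ lookup z i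
  entry z i = trans (lookup∘tabulate _ (π ⟨$⟩ʳ i)) (cong (lookup z) (Perm.inverseˡ π))

-- Conjugating a translation by `g` only permutes its vector; the translation part of `g` cancels,
-- and the permutation carries triangles to triangles.
covered-equivalent : {C M : Code n} → Equivalent C M → CoveredByTriangles M → CoveredByTriangles C
covered-equivalent {C = C} {M} (g@(x , π) , gC⊆M , M⊆gC) covered k
  with a , b , stable ← covered (π ⟨$⟩ʳ k) = π ⟨$⟩ˡ a , π ⟨$⟩ˡ b , stable′
  where
  z  = unit (π ⟨$⟩ʳ k) ⊕ (unit a ⊕ unit b)
  z′ = unit k ⊕ (unit (π ⟨$⟩ˡ a) ⊕ unit (π ⟨$⟩ˡ b))

  preimage : ∀ i → permute π (unit (π ⟨$⟩ˡ i)) ≡ unit i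
  preimage i = trans (permute-unit π (π ⟨$⟩ˡ i)) (cong unit (Perm.inverseʳ π))

  πz′≡z : permute π z′ ≡ z
  πz′≡z = trans (permute-additive π (unit k) _) (cong₂ _⊕_ (permute-unit π k)
    (trans (permute-additive π (unit (π ⟨$⟩ˡ a)) (unit (π ⟨$⟩ˡ b)))
           (cong₂ _⊕_ (preimage a) (preimage b))))

  stable′ : ∀ {w} → w ∈ C → z′ ⊕ w ∈ C
  stable′ {w} w∈C with w′ , w′∈C , gw′≡ ← M⊆gC (stable (gC⊆M (w , w∈C , refl))) =
    subst C (permute-injective π (begin
      permute π w′                         ≡⟨ ⊕-swap gw′≡ ⟩
      x ⊕ (z ⊕ (x ⊕ permute π w))          ≡⟨ cong (x ⊕_) (⊕-leftComm z x _) ⟩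
      x ⊕ (x ⊕ (z ⊕ permute π w))          ≡⟨ ⊕-cancelˡ x _ ⟩
      z ⊕ permute π w                      ≡⟨ cong (_⊕ permute π w) πz′≡z ⟨
      permute π z′ ⊕ permute π w           ≡⟨ permute-additive π z′ w ⟨
      permute π (z′ ⊕ w)                   ∎)) w′∈C

-- Kernel dimension and inequivalence to Mollard codes.

module _ {N r : ℕ} (points : Fin (suc N) ↔ F r) (X Y : QuadraticShear r)
                    (transverse : Transverse X Y) where

  open Construction points X Y transverse
  open PropelinearSyndromes syndromes using (code; perfect; propelinear; Ker⇒syndrome≡𝟎; Ker≐syndrome≡𝟎)

  kernelDimension : HasDimension (Ker code) (suc N + N ∸ (1 + (r + r)))
  kernelDimension
    with k , eq , p ← kernel-parametrisation (syndrome col) (syndrome-additive col) spanning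
    = subst (HasDimension (Ker code)) (sym (trans (cong (_∸ (1 + (r + r))) eq) (m+n∸n≡m k (1 + (r + r)))))
        (dimension-cong (Ker≐syndrome≡𝟎 spanning rigid) (parametrisation⇒dimension p))

  -- A covering word through an even coordinate would have zero syndrome. Parity forces exactly one
  -- of `a`, `b` to be even; the other is then the only Hamming coordinate, and its nonzero column
  -- is not cancelled.
  not-covered : ¬ CoveredByTriangles code
  not-covered covered with a , b , stable ← covered (evenPart origin) =
    absurd (coordinate a) (coordinate b) (begin
      triple {r} true 𝟎 𝟎 ⊕ (col a ⊕ col b)
        ≡⟨ cong₂ _⊕_ (trans (syndrome-unit col (evenPart origin)) (trans (col-even origin)
             (cong (triple true 𝟎) (Inverse.strictlyInverseˡ points 𝟎))))
             (trans (syndrome-additive col (unit a) (unit b))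
                    (cong₂ _⊕_ (syndrome-unit col a) (syndrome-unit col b))) ⟨
      syndrome col (unit (evenPart origin)) ⊕ syndrome col (unit a ⊕ unit b)
        ≡⟨ syndrome-additive col _ _ ⟨
      syndrome col (unit (evenPart origin) ⊕ (unit a ⊕ unit b))
        ≡⟨ Ker⇒syndrome≡𝟎 spanning rigid stable ⟩
      𝟎
        ≡⟨ triple-𝟎 r ⟨
      triple {r} false 𝟎 𝟎 ∎)
    where
    collect : ∀ b b′ s s′ t t′ →
              triple {r} true 𝟎 𝟎 ⊕ (triple b s t ⊕ triple b′ s′ t′) ≡ triple {r} false 𝟎 𝟎 →
              true xor (b xor b′) ≡ false × s ⊕ s′ ≡ 𝟎
    collect b b′ s s′ t t′ eq =
      let b≡ , s≡ , _ = triple-injective (trans (sym (trans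
            (cong (triple {r} true 𝟎 𝟎 ⊕_) (triple-⊕ b b′ s s′ t t′))
            (triple-⊕ true (b xor b′) 𝟎 (s ⊕ s′) 𝟎 (t ⊕ t′)))) eq)
      in b≡ , trans (sym (⊕-identityˡ _)) s≡

    absurd : ∀ {a b} → Coordinate a → Coordinate b →
             triple {r} true 𝟎 𝟎 ⊕ (col a ⊕ col b) ≢ triple {r} false 𝟎 𝟎
    absurd (even i) (even j) eq rewrite col-even i | col-even j =
      contradiction (proj₁ (collect true true 𝟎 𝟎 (to i) (to j) eq)) λ ()
      where open Inverse points using (to)
    absurd (even i) (hamming j) eq rewrite col-even i | col-hamming j =
      nonzero≢𝟎 j (trans (sym (⊕-identityˡ _)) (proj₂ (collect true false 𝟎 (nonzero j) _ 𝟎 eq)))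
    absurd (hamming i) (even j) eq rewrite col-hamming i | col-even j =
      nonzero≢𝟎 i (trans (sym (⊕-identityʳ _)) (proj₂ (collect false true (nonzero i) 𝟎 𝟎 _ eq)))
    absurd (hamming i) (hamming j) eq rewrite col-hamming i | col-hamming j =
      contradiction (proj₁ (collect false false (nonzero i) (nonzero j) 𝟎 𝟎 eq)) λ ()

  nonMollardCode : ∃ λ (C : Code (suc N + N)) → Perfect C × Propelinear C ×
    HasDimension (Ker C) (suc N + N ∸ (1 + (r + r))) × ¬ (∃ λ M → IsMollard M × Equivalent C M)
  nonMollardCode = code , perfect , propelinear , kernelDimension , λ (M , M-mollard , C~M) →
    not-covered (covered-equivalent C~M (mollard-covered M-mollard))

-- Enumeration of the points and arithmetic of the parameters.

enumeration : ∀ r → Fin (2 ^ r) ↔ F r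
enumeration zero    = mk↔ₛ′ (λ _ → []) (λ _ → zero) (λ { [] → refl }) (λ { zero → refl })
enumeration (suc r) = ∷-↔ ↔-∘ ((2↔Bool ×-↔ enumeration r) ↔-∘ *↔× {2} {2 ^ r})
  where
  ∷-↔ : (Bool × F r) ↔ F (suc r)
  ∷-↔ = mk↔ₛ′ (λ (b , v) → b ∷ v) (λ { (b ∷ v) → b , v }) (λ { (_ ∷ _) → refl }) (λ { (_ , _) → refl })

suc-pred-2^ : ∀ r → suc (pred (2 ^ r)) ≡ 2 ^ r
suc-pred-2^ r = suc-pred (2 ^ r) ⦃ m^n≢0 2 r ⦄

code-length : ∀ r → suc (pred (2 ^ r)) + pred (2 ^ r) ≡ 2 ^ (r + 1) ∸ 1
code-length r = begin
  suc N + N                  ≡⟨ +-suc N N ⟨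
  N + suc N                  ≡⟨⟩
  (suc N + suc N) ∸ 1        ≡⟨ cong (λ M → (M + M) ∸ 1) (suc-pred-2^ r) ⟩
  (2 ^ r + 2 ^ r) ∸ 1        ≡⟨ cong (λ M → (2 ^ r + M) ∸ 1) (+-identityʳ (2 ^ r)) ⟨
  2 ^ suc r ∸ 1              ≡⟨ cong (λ s → 2 ^ s ∸ 1) (+-comm 1 r) ⟩
  2 ^ (r + 1) ∸ 1            ∎
  where N = pred (2 ^ r)

kernel-dimension : ∀ M r → M ∸ 1 ∸ (1 + (r + r)) ≡ M ∸ 2 * r ∸ 2
kernel-dimension M r = begin
  M ∸ 1 ∸ (1 + (r + r))   ≡⟨ ∸-+-assoc M 1 (1 + (r + r)) ⟩
  M ∸ (2 + (r + r))       ≡⟨ cong (M ∸_) (+-comm 2 (r + r)) ⟩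
  M ∸ (r + r + 2)         ≡⟨ cong (λ s → M ∸ (r + s + 2)) (+-identityʳ r) ⟨
  M ∸ (2 * r + 2)         ≡⟨ ∸-+-assoc M (2 * r) 2 ⟨
  M ∸ 2 * r ∸ 2           ∎

propelinearNonMollard : ∀ r → 3 ≤ r → ∃ λ (C : Code (2 ^ (r + 1) ∸ 1)) → Perfect C × Propelinear C ×
  HasDimension (Ker C) (2 ^ (r + 1) ∸ 2 * r ∸ 2) × ¬ (∃ λ M → IsMollard M × Equivalent C M)
propelinearNonMollard r@(suc (suc (suc k))) (s≤s (s≤s (s≤s _))) =
  -- The inner transport changes the length n while the dimension is still written as n - (2r + 1);
  -- the outer one then rewrites the dimension.
  subst (λ d → ∃ λ (C : Code (2 ^ (r + 1) ∸ 1)) → Perfect C × Propelinear C ×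
          HasDimension (Ker C) d × ¬ (∃ λ M → IsMollard M × Equivalent C M))
    (kernel-dimension (2 ^ (r + 1)) r)
    (subst (λ n → ∃ λ (C : Code n) → Perfect C × Propelinear C ×
             HasDimension (Ker C) (n ∸ (1 + (r + r))) × ¬ (∃ λ M → IsMollard M × Equivalent C M))
      (code-length r)
      (nonMollardCode points (pathShear k) (planeShear k) (shears-transverse k)))
  where
  points : Fin (suc (pred (2 ^ r))) ↔ F r
  points = subst (λ M → Fin M ↔ F r) (sym (suc-pred-2^ r)) (enumeration r)

mainTheorem8 : ((r : ℕ) → 3 ≤ r →
    ∃ λ (C : Code (2 ^ (r + 1) ∸ 1)) →
    Perfect C × Propelinear C ×
    HasDimension (Ker C) (2 ^ (r + 1) ∸ 2 * r ∸ 2))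
    ×
    ((r : ℕ) → 3 ≤ r →
    ∃ λ (C : Code (2 ^ (r + 1) ∸ 1)) →
    Perfect C × Propelinear C ×
    ¬ (∃ λ (M : Code (2 ^ (r + 1) ∸ 1)) → IsMollard M × Equivalent C M))
mainTheorem8 =
  (λ r 3≤r → let C , perfect , propelinear , kernel , _ = propelinearNonMollard r 3≤r in
     C , perfect , propelinear , kernel) ,
  (λ r 3≤r → let C , perfect , propelinear , _ , nonMollard = propelinearNonMollard r 3≤r in
     C , perfect , propelinear , nonMollard)
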